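{- Let $n\geq 3$ and let $M(\mathcal{W}_n)$ be the graphic matroid of the wheel graph $\mathcal{W}_n$. Then the base-cobase graph $G(M(\mathcal{W}_n),M(\mathcal{W}_n)^\ast)$ is Hamiltonian connected, i.e. for any two distinct vertices $u,v$ it has a Hamiltonian path with endpoints $u$ and $v$.
   Context: The wheel graph $\mathcal{W}_n$ ($n\ge 3$) has vertices $c,v_1,\dots,v_n$, rim edges $v_iv_{i+1}$ (indices mod $n$) and spokes $cv_i$ for $i\in[n]$. For a matroid $M$ on $E$ with bases $\mathcal{B}$, a base-cobase is a base $B$ such that $E\setminus B$ is also a base; the base-cobase graph $G(M,M^\ast)$ has the base-cobases as vertices, two being adjacent iff their symmetric difference has exactly two elements. -}

module Defs where

open import Data.Nat using (ℕ; zero; suc; _+_; _≤_)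
open import Data.Nat.DivMod using (_mod_)
open import Data.Fin using (Fin; zero; suc; toℕ; splitAt; inject₁; fromℕ)
open import Data.Fin.Subset using (Subset; _∈_; _∉_; _∪_; _─_; ∁; ∣_∣; ⁅_⁆)
open import Data.Product using (_×_; _,_; ∃; Σ)
open import Data.Sum using (_⊎_; inj₁; inj₂)
open import Relation.Binary.PropositionalEquality using (_≡_; _≢_)
open import Relation.Nullary using (¬_)
open import Function.Definitions using (Injective)

next : ∀ {n} → Fin n → Fin n
next {suc m} i = suc (toℕ i) mod suc m

record Graph : Set where
  field
    nV  : ℕ
    nE  : ℕ
    ends : Fin nE → Fin nV × Fin nV
open Graph public

AdjIn : (G : Graph) → Subset (nE G) → Fin (nV G) → Fin (nV G) → Set
AdjIn G I x y = ∃ λ e → e ∈ I × (ends G e ≡ (x , y) ⊎ ends G e ≡ (y , x))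

HasCycle : (G : Graph) → Subset (nE G) → Set
HasCycle G I = Σ ℕ λ k → 3 ≤ k × Σ (Fin k → Fin (nV G)) λ f →
  Injective _≡_ _≡_ f × (∀ j → AdjIn G I (f j) (f (next j)))

Independent : (G : Graph) → Subset (nE G) → Set
Independent G I = ¬ HasCycle G I

IsBase : (G : Graph) → Subset (nE G) → Set
IsBase G B = Independent G B × (∀ e → e ∉ B → ¬ Independent G (B ∪ ⁅ e ⁆))

-- base-cobase: B is a base and E \ B is a base (i.e. B is a base of M and of M*)
IsBaseCobase : (G : Graph) → Subset (nE G) → Set
IsBaseCobase G B = IsBase G B × IsBase G (∁ B)

BCAdj : ∀ {m} → Subset m → Subset m → Set
BCAdj B B′ = ∣ (B ─ B′) ∪ (B′ ─ B) ∣ ≡ 2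

HamiltonianPath : ∀ {m} → (Subset m → Set) → (Subset m → Subset m → Set) →
                  Subset m → Subset m → Set
HamiltonianPath {m} P R u v = Σ ℕ λ k → Σ (Fin (suc k) → Subset m) λ p →
  (p zero ≡ u) × (p (fromℕ k) ≡ v) × Injective _≡_ _≡_ p ×
  (∀ j → P (p j)) × (∀ (i : Fin k) → R (p (inject₁ i)) (p (suc i))) ×
  (∀ B → P B → ∃ λ j → p j ≡ B)

HamiltonianConnected : ∀ {m} → (Subset m → Set) → (Subset m → Subset m → Set) → Set
HamiltonianConnected P R = ∀ u v → P u → P v → u ≢ v → HamiltonianPath P R u v

-- The wheel W_n: vertices Fin (suc n), 0 = hub c, suc i = v_{i+1} (rim vertex i).
-- Edges Fin (n + n): the first n are spokes c v_i, the last n rim edges v_i v_{i+1 mod n}.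
wheelEnds : (n : ℕ) → Fin (n + n) → Fin (suc n) × Fin (suc n)
wheelEnds n e with splitAt n e
... | inj₁ i = zero , suc i
... | inj₂ i = suc i , suc (next i)

Wheel : ℕ → Graph
Wheel n = record { nV = suc n ; nE = n + n ; ends = wheelEnds n }

BaseCobaseGraphHamiltonianConnected : Graph → Set
BaseCobaseGraphHamiltonianConnected G = HamiltonianConnected (IsBaseCobase G) BCAdj

{-# OPTIONS --safe #-}
-- A base-cobase of the wheel is determined by a non-constant vector x ∈ {0,1}ⁿ and a layer: reading spokes and
-- rim edges alternately around the wheel, every spoke has the colour opposite to the rim edge after it
-- (layer false) or to the rim edge before it (layer true).  For otherwise some colour class contains the rim
-- or a fan (two spokes joined by a rim path).  So the base-cobase graph consists of two copies of the n-cube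
-- without its two constant vertices, plus cross edges between cyclic intervals.
--
-- For n ≥ 5 a Hamiltonian path is pieced together from Hamiltonian paths of subcubes: full subcubes
-- (endpoints of opposite parity), subcubes without one vertex (endpoints of the other parity) and subcubes
-- without two adjacent vertices.  Each piece ends at an interval of length one or two, or at the complement of
-- one, where a cross edge leads to the next piece.  The cases n = 3, 4 are settled by explicit paths, up to the
-- cyclic symmetry of order 2n that comes from the self-duality of the wheel.
module Submission where

open import Defs
open import Data.Nat using (ℕ; _≤_)

open import Data.Bool using (Bool; true; false; not; _xor_; _∨_; if_then_else_)
import Data.Bool.Properties as Boolₚ
open import Data.Nat using (zero; suc; _+_; _∸_; _/_; _%_; _<_; _≡ᵇ_; s≤s; z≤n)
import Data.Nat.DivMod as DivMod
import Data.Nat.Properties as ℕₚ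
open import Algebra.Properties.CommutativeSemigroup ℕₚ.+-commutativeSemigroup using (x∙yz≈y∙xz)
open import Data.Fin using (Fin; zero; suc; toℕ; fromℕ; inject₁; punchOut; _↑ˡ_; _↑ʳ_)
import Data.Fin as Fin
import Data.Fin.Properties as Finₚ
open import Data.Fin.Relation.Unary.Top using (view; ‵fromℕ; ‵inject₁)
open import Data.Fin.Subset using (Subset; ∁; _∪_; _─_; ⁅_⁆; ∣_∣; _∉_)
import Data.Fin.Subset.Properties as Subsetₚ
open import Data.Vec using (Vec; []; _∷_; _∷ʳ_; _++_; lookup; insertAt; removeAt; updateAt; replicate; map; tabulate)
import Data.Vec.Properties as Vecₚ
open import Data.List using (List; []; _∷_; length; upTo; cartesianProduct; cartesianProductWith)
import Data.List as List
open import Data.List.Membership.Propositional using (_∈_)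
open import Data.List.Membership.Propositional.Properties using (∈-++⁺ˡ; ∈-++⁺ʳ; ∈-++⁻; ∈-map⁺; ∈-map⁻; ∈-lookup; ∈-cartesianProduct⁺; ∈-cartesianProductWith⁺)
import Data.List.Membership.DecPropositional as DecMembership
open import Data.List.Relation.Unary.All using (All; []; _∷_; all?)
import Data.List.Relation.Unary.All as All
import Data.List.Relation.Unary.All.Properties as Allₚ
open import Data.List.Relation.Unary.AllPairs using ([]; _∷_)
open import Data.List.Relation.Unary.Any using (Any; here; there; any?; index)
import Data.List.Relation.Unary.Any as Any
open import Data.List.Relation.Unary.Any.Properties using (lookup-index)
open import Data.List.Relation.Unary.Unique.Propositional using (Unique)
import Data.List.Relation.Unary.Unique.Propositional.Properties as Unique
import Data.List.Relation.Unary.Unique.DecPropositional as DecUnique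
open import Data.Product using (_×_; _,_; ∃; proj₁; proj₂)
import Data.Product.Properties as Productₚ
open import Data.Sum using (_⊎_; inj₁; inj₂; [_,_]′)
import Data.Sum as Sum
open import Data.Unit using (⊤; tt)
open import Data.Empty using (⊥; ⊥-elim)
open import Function using (_∘_; id)
open import Relation.Binary using (tri<; tri≈; tri>)
open import Relation.Binary.PropositionalEquality
open import Relation.Nullary using (¬_; contradiction; Dec; yes; no; ¬?)
open import Relation.Nullary.Decidable using (True; toWitness; _×-dec_; _→-dec_; map′)

-- Hamiltonian paths of induced subgraphs

-- The obstacle is parity. A cube is bipartite, so the parities of the ends of each piece are
-- forced, and the two deleted vectors `K false` and `K true` have the parities of 0 and n. A cross
-- edge between two single positions keeps the parity, one between a single and a double position
-- changes it. This is why intervals of length two occur beside those of length one, and why several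
-- constructions split on the parity of `K true`. For n ≥ 5 each layer is cut by one coordinate into
-- a facet of zeros, which loses only `K false`, and a facet of ones, which loses only `K true`. The
-- cuts of the two layers may differ, so that the endpoints can be placed in suitable halves. For
-- endpoints in different layers the upper half is the image of a lower half under the self-duality,
-- so only lower halves have to be traversed. The crossing positions must avoid the cuts, the
-- endpoints and each other. Five consecutive positions give enough room for this, which is the
-- origin of the bound five.

module _ {A : Set} (_~_ : A → A → Set) where

  data Path : A → A → List A → Set where
    stop : ∀ x → Path x x (x ∷ [])
    step : ∀ {x y z l} → x ~ y → Path y z l → Path x z (x ∷ l)

  record Cover (P : A → Set) (u v : A) : Set where
    constructor cover
    field
      {vertices} : List A
      path       : Path u v vertices
      unique     : Unique vertices
      sound      : ∀ {x} → x ∈ vertices → P x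
      complete   : ∀ {x} → P x → x ∈ vertices

module _ {A : Set} {_~_ : A → A → Set} where

  path-++ : ∀ {u x y v l m} → Path _~_ u x l → x ~ y → Path _~_ y v m → Path _~_ u v (l List.++ m)
  path-++ (stop _)   e q = step e q
  path-++ (step f p) e q = step f (path-++ p e q)

  cover-single : ∀ u → Cover _~_ (_≡ u) u u
  cover-single u = cover (stop u) ([] ∷ []) (λ { (here refl) → refl }) here

  cover-resp : ∀ {P Q : A → Set} {u v} → (∀ {x} → P x → Q x) → (∀ {x} → Q x → P x) →
               Cover _~_ P u v → Cover _~_ Q u v
  cover-resp P⇒Q Q⇒P (cover p u s c) = cover p u (P⇒Q ∘ s) (c ∘ Q⇒P)

  cover-join : ∀ {P Q : A → Set} {u x y v} → Cover _~_ P u x → x ~ y → Cover _~_ Q y v →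
               (∀ {z} → P z → Q z → ⊥) → Cover _~_ (λ z → P z ⊎ Q z) u v
  cover-join (cover {l} p u s c) e (cover q u′ s′ c′) disj =
    cover (path-++ p e q) (Unique.++⁺ u u′ λ (i , j) → disj (s i) (s′ j))
      (Sum.map s s′ ∘ ∈-++⁻ l) [ ∈-++⁺ˡ ∘ c , ∈-++⁺ʳ l ∘ c′ ]′

  cover-reverse : (∀ {x y} → x ~ y → y ~ x) → ∀ {P : A → Set} {u v} → Cover _~_ P u v → Cover _~_ P v u
  cover-reverse sy (cover p uni s c) = cover-resp s c (go p uni)
    where
    -- Membership in the old list serves as the predicate, so the reversed list never has to be
    -- named.
    go : ∀ {u v l} → Path _~_ u v l → Unique l → Cover _~_ (_∈ l) v u
    go (stop x)   _       = cover-resp here (λ { (here refl) → refl }) (cover-single x)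
    go (step e p) (a ∷ u) =
      cover-resp [ there , here ]′ (λ { (here refl) → inj₂ refl ; (there i) → inj₁ i })
        (cover-join (go p u) (sy e) (cover-single _) λ { i refl → All.lookup a i refl })

unique-map : ∀ {A B : Set} (f : A → B) {l} → (∀ {x y} → x ∈ l → y ∈ l → f x ≡ f y → x ≡ y) →
             Unique l → Unique (List.map f l)
unique-map f inj []      = []
unique-map f inj (a ∷ u) =
  Allₚ.map⁺ (All.tabulate λ i eq → All.lookup a i (inj (here refl) (there i) eq)) ∷
  unique-map f (λ i j → inj (there i) (there j)) u

-- Injectivity is asked on `P` only, because `enc` identifies the two layers at the constant
-- vectors.
cover-map : ∀ {A B : Set} {_~_ : A → A → Set} {_≈_ : B → B → Set} (f : A → B) {P : A → Set} →
            (∀ {x y} → P x → P y → f x ≡ f y → x ≡ y) → (∀ {x y} → x ~ y → f x ≈ f y) →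
            ∀ {u v} → Cover _~_ P u v → Cover _≈_ (λ b → ∃ λ a → P a × b ≡ f a) (f u) (f v)
cover-map {_~_ = _~_} {_≈_} f inj hom (cover p u s c) =
  cover (go p) (unique-map f (λ i j → inj (s i) (s j)) u)
    (λ i → let a , j , eq = ∈-map⁻ f i in a , s j , eq)
    (λ { (a , Pa , refl) → ∈-map⁺ f (c Pa) })
  where
  go : ∀ {u v l} → Path _~_ u v l → Path _≈_ (f u) (f v) (List.map f l)
  go (stop x)   = stop (f x)
  go (step e q) = step (hom e) (go q)

unique⇒lookup-injective : ∀ {A : Set} {l : List A} → Unique l →
                          ∀ {i j} → List.lookup l i ≡ List.lookup l j → i ≡ j
unique⇒lookup-injective (_ ∷ _) {zero}  {zero}  _  = refl
unique⇒lookup-injective (a ∷ _) {zero}  {suc j} eq = contradiction eq (All.lookup a (∈-lookup j))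
unique⇒lookup-injective (a ∷ _) {suc i} {zero}  eq = contradiction (sym eq) (All.lookup a (∈-lookup i))
unique⇒lookup-injective (_ ∷ u) {suc i} {suc j} eq = cong suc (unique⇒lookup-injective u eq)

cover⇒hamiltonian : ∀ {m} {P : Subset m → Set} {R : Subset m → Subset m → Set} {u v} →
                    Cover R P u v → HamiltonianPath P R u v
cover⇒hamiltonian {R = R} (cover p uni s c) with shape p
  where
  shape : ∀ {u v l} → Path R u v l → ∃ λ l′ → l ≡ u ∷ l′
  shape (stop _)   = _ , refl
  shape (step _ _) = _ , refl
... | l , refl =
  length l , List.lookup (_ ∷ l) , refl , last p , unique⇒lookup-injective uni ,
  (λ j → s (∈-lookup j)) , steps p ,
  (λ B PB → index (c PB) , sym (lookup-index (c PB)))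
  where
  last : ∀ {u v x l} → Path R u v (x ∷ l) → List.lookup (x ∷ l) (fromℕ (length l)) ≡ v
  last (stop _)             = refl
  last (step e (stop y))    = refl
  last (step e q@(step _ _)) = last q
  steps : ∀ {u v x l} → Path R u v (x ∷ l) →
          ∀ i → R (List.lookup (x ∷ l) (inject₁ i)) (List.lookup (x ∷ l) (suc i))
  steps (step e (stop y))    zero    = e
  steps (step e (step _ _)) zero    = e
  steps (step e q@(step _ _)) (suc i) = steps q i

-- Hamiltonian paths of cubes

Cube : ℕ → Set
Cube n = Vec Bool n

_≟ᶜ_ : ∀ {n} (x y : Cube n) → Dec (x ≡ y)
_≟ᶜ_ = Vecₚ.≡-dec Boolₚ._≟_

δ : Bool → Bool → ℕ
δ a b = if a xor b then 1 else 0

d : ∀ {n} → Cube n → Cube n → ℕ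
d []      []      = 0
d (a ∷ x) (b ∷ y) = δ a b + d x y

par : ∀ {n} → Cube n → Bool
par []      = false
par (a ∷ x) = a xor par x

flip : ∀ {n} → Fin n → Cube n → Cube n
flip i x = updateAt x i not

Adj : ∀ {n} → Cube n → Cube n → Set
Adj x y = d x y ≡ 1

δ-refl : ∀ a → δ a a ≡ 0
δ-refl false = refl
δ-refl true  = refl

δ-sym : ∀ a b → δ a b ≡ δ b a
δ-sym a b = cong (if_then 1 else 0) (Boolₚ.xor-comm a b)

d-refl : ∀ {n} (x : Cube n) → d x x ≡ 0
d-refl []      = refl
d-refl (a ∷ x) = cong₂ _+_ (δ-refl a) (d-refl x)

d-sym : ∀ {n} (x y : Cube n) → d x y ≡ d y x
d-sym []      []      = refl
d-sym (a ∷ x) (b ∷ y) = cong₂ _+_ (δ-sym a b) (d-sym x y)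

adj-sym : ∀ {n} {x y : Cube n} → Adj x y → Adj y x
adj-sym {x = x} {y} = trans (d-sym y x)

d-flip : ∀ {n} i (x : Cube n) → Adj x (flip i x)
d-flip zero    (false ∷ x) = cong suc (d-refl x)
d-flip zero    (true  ∷ x) = cong suc (d-refl x)
d-flip (suc i) (a ∷ x)     = cong₂ _+_ (δ-refl a) (d-flip i x)

d≡0⇒≡ : ∀ {n} (x y : Cube n) → d x y ≡ 0 → x ≡ y
d≡0⇒≡ []          []          _  = refl
d≡0⇒≡ (false ∷ x) (false ∷ y) eq = cong (false ∷_) (d≡0⇒≡ x y eq)
d≡0⇒≡ (true  ∷ x) (true  ∷ y) eq = cong (true ∷_) (d≡0⇒≡ x y eq)

not-xorˡ : ∀ a b → not a xor b ≡ not (a xor b)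
not-xorˡ false b = refl
not-xorˡ true  b = sym (Boolₚ.not-involutive b)

not-xorʳ : ∀ a b → a xor not b ≡ not (a xor b)
not-xorʳ false b = refl
not-xorʳ true  b = refl

xor-injʳ : ∀ a {b c} → a xor b ≡ a xor c → b ≡ c
xor-injʳ false eq = eq
xor-injʳ true  eq = Boolₚ.not-injective eq

par-flip : ∀ {n} i (x : Cube n) → par (flip i x) ≡ not (par x)
par-flip zero    (a ∷ x) = not-xorˡ a (par x)
par-flip (suc i) (a ∷ x) = trans (cong (a xor_) (par-flip i x)) (not-xorʳ a (par x))

par-insertAt : ∀ {n} (x : Cube n) s a → par (insertAt x s a) ≡ a xor par x
par-insertAt x       zero    a = refl
par-insertAt (b ∷ x) (suc s) a = begin
  b xor par (insertAt x s a) ≡⟨ cong (b xor_) (par-insertAt x s a) ⟩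
  b xor (a xor par x)        ≡⟨ Boolₚ.xor-assoc b a (par x) ⟨
  (b xor a) xor par x        ≡⟨ cong (_xor par x) (Boolₚ.xor-comm b a) ⟩
  (a xor b) xor par x        ≡⟨ Boolₚ.xor-assoc a b (par x) ⟩
  a xor (b xor par x)        ∎
  where open ≡-Reasoning

d-insertAt : ∀ {n} (x y : Cube n) s a b → d (insertAt x s a) (insertAt y s b) ≡ δ a b + d x y
d-insertAt x        y        zero    a b = refl
d-insertAt (a′ ∷ x) (b′ ∷ y) (suc s) a b = begin
  δ a′ b′ + d (insertAt x s a) (insertAt y s b) ≡⟨ cong (δ a′ b′ +_) (d-insertAt x y s a b) ⟩
  δ a′ b′ + (δ a b + d x y)                     ≡⟨ x∙yz≈y∙xz (δ a′ b′) (δ a b) (d x y) ⟩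
  δ a b + (δ a′ b′ + d x y)                     ∎
  where
  open ≡-Reasoning

adj⇒par : ∀ {n} (p q : Cube n) → Adj p q → par q ≡ not (par p)
adj⇒par []          []          ()
adj⇒par (false ∷ p) (false ∷ q) e = adj⇒par p q e
adj⇒par (false ∷ p) (true  ∷ q) e = cong (not ∘ par) (sym (d≡0⇒≡ p q (ℕₚ.suc-injective e)))
adj⇒par (true  ∷ p) (false ∷ q) e =
  trans (cong par (sym (d≡0⇒≡ p q (ℕₚ.suc-injective e)))) (sym (Boolₚ.not-involutive (par p)))
adj⇒par (true  ∷ p) (true  ∷ q) e = cong not (adj⇒par p q e)

b≢not : ∀ {b} → b ≢ not b
b≢not {false} ()
b≢not {true}  ()

par⇒≢ : ∀ {n} {x y : Cube n} → par y ≡ not (par x) → x ≢ y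
par⇒≢ eq refl = b≢not eq

insertAt-injective : ∀ {n} {x y : Cube n} s {a b} → insertAt x s a ≡ insertAt y s b → x ≡ y
insertAt-injective {x = x} {y} s {a} {b} eq = begin
  x                           ≡⟨ Vecₚ.removeAt-insertAt x s a ⟨
  removeAt (insertAt x s a) s ≡⟨ cong (λ z → removeAt z s) eq ⟩
  removeAt (insertAt y s b) s ≡⟨ Vecₚ.removeAt-insertAt y s b ⟩
  y                           ∎
  where open ≡-Reasoning

data SplitAt {n} (s : Fin (suc n)) : Cube (suc n) → Set where
  _at_ : ∀ x a → SplitAt s (insertAt x s a)

splitAt : ∀ {n} (s : Fin (suc n)) (u : Cube (suc n)) → SplitAt s u
splitAt s u = subst (SplitAt s) (Vecₚ.insertAt-removeAt u s) (removeAt u s at lookup u s)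

lookup-insertAt : ∀ {n} (x : Cube n) s a → lookup (insertAt x s a) s ≡ a
lookup-insertAt = Vecₚ.insertAt-lookup

differ : ∀ {n} (u v : Cube n) → u ≢ v → ∃ λ s → lookup v s ≡ not (lookup u s)
differ []      []      u≢v = contradiction refl u≢v
differ (a ∷ u) (b ∷ v) u≢v with b Boolₚ.≟ a
... | no  b≢a  = zero , Boolₚ.¬-not b≢a
... | yes refl = let s , eq = differ u v (u≢v ∘ cong (a ∷_)) in suc s , eq

In : ∀ {n} → Fin (suc n) → Bool → (Cube n → Set) → Cube (suc n) → Set
In s a P y = ∃ λ x → P x × y ≡ insertAt x s a

cover-face : ∀ {n} {P : Cube n → Set} {u v} s a → Cover Adj P u v →
             Cover Adj (In s a P) (insertAt u s a) (insertAt v s a)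
cover-face s a = cover-map (λ x → insertAt x s a) (λ _ _ → insertAt-injective s)
  λ {x} {y} e → trans (d-insertAt x y s a a) (cong₂ _+_ (δ-refl a) e)

In-disjoint : ∀ {n} s a {P Q : Cube n → Set} {y} → In s a P y → In s (not a) Q y → ⊥
In-disjoint s a (x , _ , refl) (x′ , _ , eq) =
  b≢not (trans (sym (lookup-insertAt x s a)) (trans (cong (λ z → lookup z s) eq) (lookup-insertAt x′ s
    (not a))))

cover-glue : ∀ {n} {P Q : Cube n → Set} {u x v} s a → Cover Adj P u x → Cover Adj Q x v →
             Cover Adj (λ y → In s a P y ⊎ In s (not a) Q y) (insertAt u s a) (insertAt v s (not a))
cover-glue {x = x} s a c c′ =
  cover-join (cover-face s a c) e (cover-face s (not a) c′) (In-disjoint s a)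
  where
  δ-not : ∀ a → δ a (not a) ≡ 1
  δ-not false = refl
  δ-not true  = refl
  e : Adj (insertAt x s a) (insertAt x s (not a))
  e = trans (d-insertAt x x s a (not a)) (cong₂ _+_ (δ-not a) (d-refl x))

In-cases : ∀ {n} s a (y : Cube (suc n)) → (∃ λ x → y ≡ insertAt x s a) ⊎ (∃ λ x → y ≡ insertAt x s (not a))
In-cases s a y with splitAt s y
... | x at b with b Boolₚ.≟ a
... | yes refl = inj₁ (x , refl)
... | no  b≢a  = inj₂ (x , cong (insertAt x s) (Boolₚ.¬-not b≢a))

xor-opp-opp : ∀ a {p q} → not a xor q ≡ not (a xor p) → q ≡ p
xor-opp-opp a eq = xor-injʳ a (Boolₚ.not-injective (trans (sym (not-xorˡ a _)) eq))

xor-opp-same : ∀ a {p q} → not a xor q ≡ a xor p → q ≡ not p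
xor-opp-same a {p} {q} eq = xor-injʳ a (begin
  a xor q             ≡⟨ Boolₚ.not-involutive _ ⟨
  not (not (a xor q)) ≡⟨ cong not (not-xorˡ a q) ⟨
  not (not a xor q)   ≡⟨ cong not eq ⟩
  not (a xor p)       ≡⟨ not-xorʳ a p ⟨
  a xor not p         ∎)
  where open ≡-Reasoning

cover-rev : ∀ {n} {P : Cube n → Set} {u v} → Cover Adj P u v → Cover Adj P v u
cover-rev = cover-reverse λ {x} {y} → adj-sym {x = x} {y}

Whole : ∀ {n} → Cube n → Set
Whole _ = ⊤

-- Cut along a coordinate where u and v differ. Their projections then have equal parity, so any
-- neighbour of the first is a valid crossing point: both facets get ends of opposite parity.
lace : ∀ {n} (u v : Cube n) → par v ≡ not (par u) → Cover Adj Whole u v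
lace {zero}  []  []  ()
lace {suc n} u v opp with differ u v (par⇒≢ opp)
... | s , us≢vs with splitAt s u | splitAt s v
... | x at a | y at b
  rewrite lookup-insertAt x s a | lookup-insertAt y s b | us≢vs | par-insertAt x s a | par-insertAt y s
    (not a) =
  cover-resp _ (λ {z} _ → Sum.map (λ (w , eq) → w , tt , eq) (λ (w , eq) → w , tt , eq) (In-cases s a z))
    (go x y (xor-opp-opp a opp))
  where
  go : ∀ {n} {s : Fin (suc n)} (x y : Cube n) → par y ≡ par x →
       Cover Adj (λ z → In s a Whole z ⊎ In s (not a) Whole z) (insertAt x s a) (insertAt y s (not a))
  go {zero}  []  []  _ = cover-glue _ a (cover-resp _ (λ { {[]} _ → refl }) (cover-single [])) (cover-resp _
    (λ { {[]} _ → refl }) (cover-single []))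
  go {suc n} x y eq =
    cover-glue _ a (lace x (flip zero x) (par-flip zero x))
      (lace (flip zero x) y (trans eq (trans (sym (Boolₚ.not-involutive _)) (cong not (sym
        (par-flip zero x))))))

lookup-flip : ∀ {n} i (x : Cube n) → lookup (flip i x) i ≡ not (lookup x i)
lookup-flip i x = Vecₚ.lookup∘updateAt i x

flip-flip : ∀ {n} i (x : Cube n) → flip i (flip i x) ≡ x
flip-flip zero    (a ∷ x) = cong (_∷ x) (Boolₚ.not-involutive a)
flip-flip (suc i) (a ∷ x) = cong (a ∷_) (flip-flip i x)

lookup-flip-≢ : ∀ {n} {i j} → i ≢ j → (x : Cube n) → lookup (flip j x) i ≡ lookup x i
lookup-flip-≢ {i = i} {j} i≢j x = Vecₚ.lookup∘updateAt′ i j i≢j x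

flip-≢ : ∀ {n} {i j : Fin n} → i ≢ j → (x : Cube n) → flip i x ≢ flip j x
flip-≢ {i = i} {j} i≢j x eq = b≢not (begin
  lookup x i          ≡⟨ lookup-flip-≢ i≢j x ⟨
  lookup (flip j x) i ≡⟨ cong (λ z → lookup z i) eq ⟨
  lookup (flip i x) i ≡⟨ lookup-flip i x ⟩
  not (lookup x i)    ∎)
  where open ≡-Reasoning

-- In the case analyses below, s is a coordinate on which the endpoints differ,
-- so each endpoint lives in its own facet, and the deleted vertices all lie in one facet.
mutual
  miss₁ : ∀ {n} (w u v : Cube n) → par u ≡ not (par w) → par v ≡ par u → u ≢ v → Cover Adj (_≢ w) u v
  miss₁ {zero}  w []  []  _  _  u≢v = contradiction refl u≢v
  miss₁ {suc n} w u v pu pv u≢v with differ u v u≢v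
  ... | s , us≢vs with splitAt s w | splitAt s u | splitAt s v
  ... | w′ at c | x at a | y at b
    rewrite lookup-insertAt x s a | lookup-insertAt y s b | us≢vs
          | par-insertAt w′ s c | par-insertAt x s a | par-insertAt y s (not a)
    with c Boolₚ.≟ a
  ... | yes refl = miss₁-step s c w′ x y (xor-injʳ c (trans pu (sym (not-xorʳ c (par w′))))) (xor-opp-same c pv)
  ... | no  c≢a rewrite Boolₚ.¬-not c≢a = cover-rev
    (subst (λ e → Cover Adj (_≢ insertAt w′ s (not a)) (insertAt y s (not a)) (insertAt x s e))
      (Boolₚ.not-involutive a)
      (miss₁-step s (not a) w′ y x
        (xor-injʳ (not a) (trans pv (trans pu (sym (not-xorʳ (not a) (par w′))))))
        (trans (sym (Boolₚ.not-involutive _)) (cong not (sym (xor-opp-same a pv))))))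

  -- The facet with the hole is traversed from x to some m of the same parity; the opposite facet is
  -- complete and is laced from m to y.
  miss₁-step : ∀ {n} s a (w x y : Cube n) → par x ≡ not (par w) → par y ≡ not (par x) →
               Cover Adj (_≢ insertAt w s a) (insertAt x s a) (insertAt y s (not a))
  miss₁-step s a w x y px py with miss₁-some w x px
  ... | m , pm , c = cover-resp
    (λ { (inj₁ (z , z≢w , refl)) eq → z≢w (insertAt-injective s eq)
       ; (inj₂ (z , _ , refl)) eq → b≢not {a} (trans (sym (lookup-insertAt w s a)) (trans (cong (λ z →
         lookup z s) (sym eq)) (lookup-insertAt z s (not a)))) })
    (λ {z} z≢w → Sum.map (λ { (z′ , refl) → z′ , (λ { refl → z≢w refl }) , refl }) (λ { (z′ , refl) → z′ , tt ,
      refl }) (In-cases s a z))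
    (cover-glue s a c (lace m y (trans py (cong not (sym pm)))))

  -- The far end is left free, since the caller can cross to the opposite facet at any vertex of the
  -- right parity. This covers dimension one, where a single vertex remains and the path cannot have
  -- distinct ends.
  miss₁-some : ∀ {n} (w u : Cube n) → par u ≡ not (par w) → ∃ λ v → par v ≡ par u × Cover Adj (_≢ w) u v
  miss₁-some {zero}        []      []      ()
  miss₁-some {suc zero}    (a ∷ []) (b ∷ []) eq = _ , refl ,
    cover-resp (λ { refl refl → b≢not eq }) (λ { {c ∷ []} c≢a → cong (_∷ []) (only c≢a eq) }) (cover-single
      (b ∷ []))
    where
    only : ∀ {a b c} → _≢_ {A = Cube 1} (c ∷ []) (a ∷ []) → b xor false ≡ not (a xor false) → c ≡ b
    only {false} {true}  {false} c≢a eq = contradiction refl c≢a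
    only {false} {true}  {true}  c≢a eq = refl
    only {true}  {false} {false} c≢a eq = refl
    only {true}  {false} {true}  c≢a eq = contradiction refl c≢a
  miss₁-some {suc (suc n)} w u eq = v , pv , miss₁ w u v eq pv (λ eq → flip-≢ (λ ()) u (trans (cong
    (flip zero) eq) (flip-flip zero _)))
    where
    v = flip zero (flip (suc zero) u)
    pv : par v ≡ par u
    pv = trans (par-flip zero (flip (suc zero) u)) (trans (cong not (par-flip (suc zero) u))
      (Boolₚ.not-involutive (par u)))

d-head-≢ : ∀ {n a b} {p q : Cube n} → b ≢ a → Adj (a ∷ p) (b ∷ q) → p ≡ q
d-head-≢ {a = false} {false} b≢a _ = contradiction refl b≢a
d-head-≢ {a = false} {true}  _   e = d≡0⇒≡ _ _ (ℕₚ.suc-injective e)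
d-head-≢ {a = true}  {false} _   e = d≡0⇒≡ _ _ (ℕₚ.suc-injective e)
d-head-≢ {a = true}  {true}  b≢a _ = contradiction refl b≢a

-- p and q differ in one coordinate; if u agreed with them on all the others, it would be one of
-- them.
separate : ∀ {n} (p q u : Cube n) → Adj p q → u ≢ p → u ≢ q →
           ∃ λ s → lookup q s ≡ lookup p s × lookup u s ≡ not (lookup p s)
separate []      []      []      () _   _
separate (a ∷ p) (b ∷ q) (c ∷ u) e u≢p u≢q with b Boolₚ.≟ a
... | yes refl rewrite δ-refl a = go (c Boolₚ.≟ a)
  where
  go : Dec (c ≡ a) → _
  go (no  c≢a)  = zero , refl , Boolₚ.¬-not c≢a
  go (yes refl) = let s , i , j = separate p q u e (u≢p ∘ cong (c ∷_)) (u≢q ∘ cong (c ∷_)) in suc s , i , j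
... | no b≢a with refl ← d-head-≢ {p = p} {q} b≢a e =
  let s , eq = differ p u tail≢ in suc s , refl , eq
  where
  tail≢ : p ≢ u
  tail≢ refl with c Boolₚ.≟ a
  ... | yes refl = u≢p refl
  ... | no  c≢a  = u≢q (cong (_∷ p) (trans (Boolₚ.¬-not c≢a) (sym (Boolₚ.¬-not b≢a))))

-- Neighbours of u share one parity while p and q have different ones, so at most one of p and q is
-- a neighbour of u, and it spoils at most one of two flips.
flip-avoiding : ∀ {n} (p q u : Cube (suc (suc n))) → Adj p q → ∃ λ i → flip i u ≢ p × flip i u ≢ q
flip-avoiding p q u e with flip zero u ≟ᶜ p | flip zero u ≟ᶜ q
... | no ≢p    | no ≢q    = zero , ≢p , ≢q
... | yes refl | _        = suc zero , flip-≢ (λ ()) u ,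
  par⇒≢ (trans (adj⇒par (flip zero u) q e) (cong not (trans (par-flip zero u) (sym (par-flip (suc zero) u)))))
... | no _     | yes refl = suc zero ,
  par⇒≢ (trans (adj⇒par (flip zero u) p (adj-sym {x = p} e)) (cong not (trans (par-flip zero u) (sym (par-flip
    (suc zero) u))))) ,
  flip-≢ (λ ()) u

Miss₂ : ∀ {n} → Cube n → Cube n → Cube n → Set
Miss₂ p q y = y ≢ p × y ≢ q

insertAt-≢ : ∀ {n} s {a} {x y : Cube n} → insertAt x s (not a) ≢ insertAt y s a
insertAt-≢ s {a} {x} {y} eq =
  b≢not (trans (sym (lookup-insertAt y s a)) (trans (cong (λ z → lookup z s) (sym eq)) (lookup-insertAt x s
    (not a))))

adj-face : ∀ {n} s a (p q : Cube n) → Adj (insertAt p s a) (insertAt q s a) → Adj p q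
adj-face s a p q e = trans (cong (_+ d p q) (sym (δ-refl a))) (trans (sym (d-insertAt p q s a a)) e)

miss₂-glue : ∀ {n} s a (p q x m y : Cube n) → Cover Adj (Miss₂ p q) x m → Cover Adj Whole m y →
             Cover Adj (Miss₂ (insertAt p s a) (insertAt q s a)) (insertAt x s a) (insertAt y s (not a))
miss₂-glue s a p q x m y c c′ = cover-resp
  (λ { (inj₁ (z , (z≢p , z≢q) , refl)) → z≢p ∘ insertAt-injective s , z≢q ∘ insertAt-injective s
     ; (inj₂ (z , _ , refl))           → insertAt-≢ s , insertAt-≢ s })
  (λ {z} (z≢p , z≢q) → Sum.map
     (λ { (z′ , refl) → z′ , ((λ { refl → z≢p refl }) , (λ { refl → z≢q refl })) , refl })
     (λ { (z′ , refl) → z′ , tt , refl })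
     (In-cases s a z))
  (cover-glue s a c c′)

SomeMiss₂ : ℕ → Set
SomeMiss₂ n = ∀ (p q u : Cube n) → Adj p q → u ≢ p → u ≢ q →
              ∃ λ v → par v ≡ not (par u) × Cover Adj (Miss₂ p q) u v

-- u lies in the facet opposite to the deleted edge. That facet is laced from u to a neighbour
-- which, moved across, avoids the edge; the facet with the edge is then left to the recursion.
miss₂-step : ∀ {n} → SomeMiss₂ n → ∀ s a (p q u : Cube n) → Adj p q → ∃ λ v → par v ≡ not (par (insertAt u s
  (not a))) ×
     Cover Adj (Miss₂ (insertAt p s a) (insertAt q s a)) (insertAt u s (not a)) v
miss₂-step {zero} ih s a []       []        u ()
-- Here the deleted edge is the whole facet, and only the opposite one has to be traversed.
miss₂-step {suc zero} ih s a (b ∷ []) (b′ ∷ []) u e =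
  insertAt (flip zero u) s (not a) ,
  trans (par-insertAt (flip zero u) s (not a)) (trans (cong (not a xor_) (par-flip zero u)) (trans (not-xorʳ
    (not a) (par u)) (cong not (sym (par-insertAt u s (not a)))))) ,
  cover-resp (λ { (z , _ , refl) → insertAt-≢ s , insertAt-≢ s })
    (λ {z} (z≢p , z≢q) → [ (λ { (z′ , refl) → ⊥-elim (none b b′ z′ e (λ { refl → z≢p refl }) (λ { refl →
      z≢q refl })) }) , (λ { (z′ , refl) → z′ , tt , refl }) ]′ (In-cases s a z))
    (cover-face s (not a) (lace u (flip zero u) (par-flip zero u)))
  where
  none : ∀ b b′ (z : Cube 1) → Adj (b ∷ []) (b′ ∷ []) → z ≢ b ∷ [] → z ≢ b′ ∷ [] → ⊥
  none false true  (false ∷ []) e z≢b z≢b′ = z≢b refl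
  none false true  (true  ∷ []) e z≢b z≢b′ = z≢b′ refl
  none true  false (false ∷ []) e z≢b z≢b′ = z≢b′ refl
  none true  false (true  ∷ []) e z≢b z≢b′ = z≢b refl
miss₂-step {suc (suc n)} ih s a p q u e with flip-avoiding p q u e
... | i , m≢p , m≢q with ih p q (flip i u) e m≢p m≢q
... | y , py , c =
  insertAt y s a ,
  (begin
    par (insertAt y s a)             ≡⟨ par-insertAt y s a ⟩
    a xor par y                      ≡⟨ cong (a xor_) (trans py (trans (cong not (par-flip i u))
      (Boolₚ.not-involutive _))) ⟩
    a xor par u                      ≡⟨ Boolₚ.not-involutive _ ⟨
    not (not (a xor par u))          ≡⟨ cong not (not-xorˡ a (par u)) ⟨
    not (not a xor par u)            ≡⟨ cong not (par-insertAt u s (not a)) ⟨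
    not (par (insertAt u s (not a))) ∎) ,
  cover-rev
    (miss₂-glue s a p q y (flip i u) u (cover-rev c)
      (cover-rev (lace u (flip i u) (par-flip i u))))
  where open ≡-Reasoning

miss₂-some : ∀ n → SomeMiss₂ n
miss₂-some zero    []  []  []  _ u≢p _ = contradiction refl u≢p
miss₂-some (suc n) p q u e u≢p u≢q with separate p q u e u≢p u≢q
... | s , qs , us with splitAt s p | splitAt s q | splitAt s u
... | p′ at a | q′ at b | u′ at c
  rewrite lookup-insertAt p′ s a | lookup-insertAt q′ s b | lookup-insertAt u′ s c | qs | us =
  miss₂-step (miss₂-some n) s a p′ q′ u′ (adj-face s a p′ q′ e)

-- The coordinate s puts the deleted edge into the facet of exactly one endpoint. Such an s must be
-- assumed: if in the 3-cube uv is the edge antipodal to pq, deleting p and q leaves two squares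
-- sharing uv, and no Hamiltonian path joins u to v.
miss₂ : ∀ {n} (p q u v : Cube n) → Adj p q → Miss₂ p q u → Miss₂ p q v → par v ≡ not (par u) →
        (∃ λ s → lookup q s ≡ lookup p s × lookup v s ≡ not (lookup u s)) → Cover Adj (Miss₂ p q) u v
miss₂ {suc n} p q u v e (u≢p , u≢q) (v≢p , v≢q) opp (s , qs , vs)
  with splitAt s p | splitAt s q | splitAt s u | splitAt s v
... | p′ at a | q′ at b | x at c | y at f
  rewrite lookup-insertAt p′ s a | lookup-insertAt q′ s b | lookup-insertAt x s c | lookup-insertAt y s f | qs | vs
        | par-insertAt x s c | par-insertAt y s (not c)
  with c Boolₚ.≟ a
... | yes refl with miss₂-some n p′ q′ x (adj-face s a p′ q′ e) (λ { refl → u≢p refl }) (λ { refl → u≢q refl })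
... | m , pm , cov = miss₂-glue s a p′ q′ x m y cov
  (lace m y (trans (xor-opp-opp c opp) (trans (sym (Boolₚ.not-involutive _)) (cong not (sym pm)))))
miss₂ {suc n} p q u v e (u≢p , u≢q) (v≢p , v≢q) opp (s , qs , vs)
  | p′ at a | q′ at b | x at c | y at f
  | no c≢a rewrite Boolₚ.¬-not c≢a | Boolₚ.not-involutive a
  with miss₂-some n p′ q′ y (adj-face s a p′ q′ e) (λ { refl → v≢p refl }) (λ { refl → v≢q refl })
... | m , pm , cov = cover-rev (miss₂-glue s a p′ q′ y m x cov
  (lace m x (trans (sym (xor-opp-opp (not a) (trans (cong (_xor par y) (Boolₚ.not-involutive a)) opp))) (trans
    (sym (Boolₚ.not-involutive _)) (cong not (sym pm))))))

-- Faces

par-removeAt : ∀ {n} (u : Cube (suc n)) t → par u ≡ lookup u t xor par (removeAt u t)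
par-removeAt u t = trans (cong par (sym (Vecₚ.insertAt-removeAt u t))) (par-insertAt (removeAt u t) t
  (lookup u t))

removeAt-injective : ∀ {n} {u v : Cube (suc n)} t → lookup u t ≡ lookup v t → removeAt u t ≡ removeAt v t →
  u ≡ v
removeAt-injective {u = u} {v} t eq eq′ =
  trans (sym (Vecₚ.insertAt-removeAt u t))
    (trans (cong₂ (λ x a → insertAt x t a) eq′ eq) (Vecₚ.insertAt-removeAt v t))

par-face : ∀ {n} {u v : Cube (suc n)} t → lookup u t ≡ lookup v t → par v ≡ par u →
           par (removeAt v t) ≡ par (removeAt u t)
par-face {u = u} {v} t ut eq = xor-injʳ (lookup v t)
  (trans (sym (par-removeAt v t)) (trans eq (trans (par-removeAt u t) (cong (_xor _) ut))))

par-face-not : ∀ {n} {u v : Cube (suc n)} t → lookup u t ≡ lookup v t → par v ≡ not (par u) →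
               par (removeAt v t) ≡ not (par (removeAt u t))
par-face-not {u = u} {v} t ut eq = xor-injʳ (lookup v t)
  (trans (sym (par-removeAt v t)) (trans eq (trans (cong not (trans (par-removeAt u t) (cong (_xor _) ut)))
    (sym (not-xorʳ (lookup v t) _)))))

cover-removeAt : ∀ {n} {P : Cube n → Set} {u v : Cube (suc n)} {a} t → lookup u t ≡ a → lookup v t ≡ a →
                 Cover Adj P (removeAt u t) (removeAt v t) →
                 Cover Adj (λ y → lookup y t ≡ a × P (removeAt y t)) u v
cover-removeAt {P = P} {u} {v} t refl vt c =
  subst₂ (Cover Adj _) (Vecₚ.insertAt-removeAt u t)
    (trans (cong (insertAt _ t) (sym vt)) (Vecₚ.insertAt-removeAt v t))
    (cover-resp
      (λ { (x , Px , refl) → lookup-insertAt x t _ , subst P (sym (Vecₚ.removeAt-insertAt x t _)) Px })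
      (λ {y} (yt , Py) → removeAt y t , Py , trans (sym (Vecₚ.insertAt-removeAt y t)) (cong (insertAt _ t) yt))
      (cover-face t (lookup u t) c))

lace-face : ∀ {n} {u v : Cube (suc n)} {a} t → lookup u t ≡ a → lookup v t ≡ a → par v ≡ not (par u) →
            Cover Adj (λ y → lookup y t ≡ a) u v
lace-face {u = u} {v} t ut vt pv = cover-resp proj₁ (_, tt)
  (cover-removeAt t ut vt (lace _ _ (par-face-not {u = u} {v} t (trans ut (sym vt)) pv)))

miss₁-face : ∀ {n} {w u v : Cube (suc n)} {a} t → lookup w t ≡ a → lookup u t ≡ a → lookup v t ≡ a →
             par u ≡ not (par w) → par v ≡ par u → u ≢ v →
             Cover Adj (λ y → lookup y t ≡ a × y ≢ w) u v
miss₁-face {w = w} {u} {v} t wt ut vt pu pv u≢v = cover-resp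
  (λ { (yt , y≢w) → yt , λ { refl → y≢w refl } })
  (λ {y} (yt , y≢w) → yt , λ eq → y≢w (removeAt-injective t (trans yt (sym wt)) eq))
  (cover-removeAt t ut vt
    (miss₁ (removeAt w t) (removeAt u t) (removeAt v t)
      (par-face-not {u = w} {u} t (trans wt (sym ut)) pu) (par-face {u = u} {v} t (trans ut (sym vt)) pv)
      (u≢v ∘ removeAt-injective t (trans ut (sym vt)))))

miss₂-face : ∀ {n} {p q u v : Cube (suc n)} {a} t →
             lookup p t ≡ a → lookup q t ≡ a → lookup u t ≡ a → lookup v t ≡ a →
             Adj p q → Miss₂ p q u → Miss₂ p q v → par v ≡ not (par u) →
             (∃ λ s → lookup q s ≡ lookup p s × lookup v s ≡ not (lookup u s)) →
             Cover Adj (λ y → lookup y t ≡ a × Miss₂ p q y) u v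
miss₂-face {p = p} {q} {u} {v} {a} t pt qt ut vt e (u≢p , u≢q) (v≢p , v≢q) pv (s , qs , vs) = cover-resp
  (λ { (yt , y≢p , y≢q) → yt , (λ { refl → y≢p refl }) , (λ { refl → y≢q refl }) })
  (λ (yt , y≢p , y≢q) → yt , y≢p ∘ removeAt-injective t (trans yt (sym pt)) , y≢q ∘ removeAt-injective t
    (trans yt (sym qt)))
  (cover-removeAt t ut vt
    (miss₂ (removeAt p t) (removeAt q t) (removeAt u t) (removeAt v t)
      (adj-face t a (removeAt p t) (removeAt q t) (subst₂ Adj (restore {p} pt) (restore {q} qt) e))
      (u≢p ∘ removeAt-injective t (trans ut (sym pt)) , u≢q ∘ removeAt-injective t (trans ut (sym qt)))
      (v≢p ∘ removeAt-injective t (trans vt (sym pt)) , v≢q ∘ removeAt-injective t (trans vt (sym qt)))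
      (par-face-not {u = u} {v} t (trans ut (sym vt)) pv)
      -- The separating coordinate survives the restriction to the facet, as u and v agree at t.
      (punchOut t≢s , trans (bit q) (trans qs (sym (bit p))) , trans (bit v) (trans vs (cong not (sym
        (bit u)))))))
  where
  restore : ∀ {x : Cube _} → lookup x t ≡ a → x ≡ insertAt (removeAt x t) t a
  restore {x} xt = trans (sym (Vecₚ.insertAt-removeAt x t)) (cong (insertAt _ t) xt)
  t≢s : t ≢ s
  t≢s refl = b≢not (trans (trans ut (sym vt)) vs)
  bit : ∀ x → lookup (removeAt x t) (punchOut t≢s) ≡ lookup x s
  bit x = Vecₚ.removeAt-punchOut x t≢s

lace-face² : ∀ {n} {u v : Cube (suc (suc n))} {a b t s} → t ≢ s →
             lookup u t ≡ a → lookup v t ≡ a → lookup u s ≡ b → lookup v s ≡ b → par v ≡ not (par u) →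
             Cover Adj (λ y → lookup y t ≡ a × lookup y s ≡ b) u v
lace-face² {u = u} {v} {t = t} t≢s ut vt us vs pv = cover-resp
  (λ {y} (yt , ys) → yt , trans (sym (bit y)) ys) (λ {y} (yt , ys) → yt , trans (bit y) ys)
  (cover-removeAt t ut vt
    (lace-face (punchOut t≢s) (trans (bit u) us) (trans (bit v) vs) (par-face-not {u = u} {v} t (trans ut
      (sym vt)) pv)))
  where
  bit : ∀ x → lookup (removeAt x t) (punchOut t≢s) ≡ lookup x _
  bit x = Vecₚ.removeAt-punchOut x t≢s

miss₁-face² : ∀ {n} {w u v : Cube (suc (suc n))} {a b t s} → t ≢ s →
              lookup w t ≡ a → lookup u t ≡ a → lookup v t ≡ a →
              lookup w s ≡ b → lookup u s ≡ b → lookup v s ≡ b →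
              par u ≡ not (par w) → par v ≡ par u → u ≢ v →
              Cover Adj (λ y → lookup y t ≡ a × lookup y s ≡ b × y ≢ w) u v
miss₁-face² {w = w} {u} {v} {t = t} t≢s wt ut vt ws us vs pu pv u≢v = cover-resp
  (λ {y} (yt , ys , y≢w) → yt , trans (sym (bit y)) ys , λ { refl → y≢w refl })
  (λ {y} (yt , ys , y≢w) → yt , trans (bit y) ys , y≢w ∘ removeAt-injective t (trans yt (sym wt)))
  (cover-removeAt t ut vt
    (miss₁-face (punchOut t≢s) (trans (bit w) ws) (trans (bit u) us) (trans (bit v) vs)
      (par-face-not {u = w} {u} t (trans wt (sym ut)) pu) (par-face {u = u} {v} t (trans ut (sym vt)) pv)
      (u≢v ∘ removeAt-injective t (trans ut (sym vt)))))
  where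
  bit : ∀ x → lookup (removeAt x t) (punchOut t≢s) ≡ lookup x _
  bit x = Vecₚ.removeAt-punchOut x t≢s

-- Cyclic successors

-- An abstract copy of next, whose unfolding would otherwise hamper unification.
abstract
  nxt : ∀ {m} → Fin (suc m) → Fin (suc m)
  nxt = next

  nxt≡next : ∀ {m} (i : Fin (suc m)) → nxt i ≡ next i
  nxt≡next _ = refl

toℕ-nxt : ∀ {m} (i : Fin (suc m)) → toℕ (nxt i) ≡ suc (toℕ i) % suc m
toℕ-nxt i = trans (cong toℕ (nxt≡next i)) (Finₚ.toℕ-fromℕ< _)

nxt-inject₁ : ∀ {m} (i : Fin m) → nxt (inject₁ i) ≡ suc i
nxt-inject₁ {m} i = Finₚ.toℕ-injective (begin
  toℕ (nxt (inject₁ i))         ≡⟨ toℕ-nxt (inject₁ i) ⟩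
  suc (toℕ (inject₁ i)) % suc m ≡⟨ cong (λ k → suc k % suc m) (Finₚ.toℕ-inject₁ i) ⟩
  suc (toℕ i) % suc m           ≡⟨ DivMod.m<n⇒m%n≡m (s≤s (Finₚ.toℕ<n i)) ⟩
  suc (toℕ i)                   ∎)
  where open ≡-Reasoning

nxt-fromℕ : ∀ m → nxt (fromℕ m) ≡ zero
nxt-fromℕ m = Finₚ.toℕ-injective (begin
  toℕ (nxt (fromℕ m))         ≡⟨ toℕ-nxt (fromℕ m) ⟩
  suc (toℕ (fromℕ m)) % suc m ≡⟨ cong (λ k → suc k % suc m) (Finₚ.toℕ-fromℕ m) ⟩
  suc m % suc m               ≡⟨ DivMod.n%n≡0 (suc m) ⟩
  0                           ∎)
  where open ≡-Reasoning

prev : ∀ {m} → Fin (suc m) → Fin (suc m)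
prev {m} zero    = fromℕ m
prev     (suc i) = inject₁ i

nxt-prev : ∀ {m} (i : Fin (suc m)) → nxt (prev i) ≡ i
nxt-prev {m} zero    = nxt-fromℕ m
nxt-prev     (suc i) = nxt-inject₁ i

prev-nxt : ∀ {m} (i : Fin (suc m)) → prev (nxt i) ≡ i
prev-nxt i with view i
... | ‵fromℕ {m}  = cong prev (nxt-fromℕ m)
... | ‵inject₁ i′ = cong prev (nxt-inject₁ i′)

nxt-injective : ∀ {m} {i j : Fin (suc m)} → nxt i ≡ nxt j → i ≡ j
nxt-injective {i = i} {j} eq = trans (sym (prev-nxt i)) (trans (cong prev eq) (prev-nxt j))

nxt^ : ∀ {m} → ℕ → Fin (suc m) → Fin (suc m)
nxt^ zero    i = i
nxt^ (suc k) i = nxt (nxt^ k i)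

toℕ-nxt^ : ∀ {m} k (i : Fin (suc m)) → toℕ (nxt^ k i) ≡ (k + toℕ i) % suc m
toℕ-nxt^ {m} zero    i = sym (DivMod.m<n⇒m%n≡m (Finₚ.toℕ<n i))
toℕ-nxt^ {m} (suc k) i = begin
  toℕ (nxt (nxt^ k i))             ≡⟨ toℕ-nxt (nxt^ k i) ⟩
  suc (toℕ (nxt^ k i)) % suc m    ≡⟨ cong (λ x → suc x % suc m) (toℕ-nxt^ k i) ⟩
  suc ((k + toℕ i) % suc m) % suc m ≡⟨ suc-% (k + toℕ i) ⟩
  suc (k + toℕ i) % suc m          ∎
  where
  open ≡-Reasoning
  suc-% : ∀ x → suc (x % suc m) % suc m ≡ suc x % suc m
  suc-% x = begin
    suc (x % suc m) % suc m                 ≡⟨ DivMod.%-distribˡ-+ 1 (x % suc m) (suc m) ⟩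
    (1 % suc m + x % suc m % suc m) % suc m ≡⟨ cong (λ y → (1 % suc m + y) % suc m) (DivMod.m%n%n≡m%n x
      (suc m)) ⟩
    (1 % suc m + x % suc m) % suc m         ≡⟨ DivMod.%-distribˡ-+ 1 x (suc m) ⟨
    suc x % suc m                           ∎

-- The position reached is i + k or i + k - n, according to whether the walk wraps around; neither
-- equals i.
nxt^-≢ : ∀ {m} k (i : Fin (suc m)) → 0 < k → k < suc m → nxt^ k i ≢ i
nxt^-≢ {m} k i 0<k k<n eq with k + toℕ i ℕₚ.<? suc m
... | yes lt = ℕₚ.<-irrefl (sym (ℕₚ.+-cancelʳ-≡ (toℕ i) k 0 (begin
  k + toℕ i           ≡⟨ DivMod.m<n⇒m%n≡m lt ⟨
  (k + toℕ i) % suc m ≡⟨ toℕ-nxt^ k i ⟨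
  toℕ (nxt^ k i)     ≡⟨ cong toℕ eq ⟩
  toℕ i               ∎))) 0<k
  where open ≡-Reasoning
... | no nlt = ℕₚ.<-irrefl (ℕₚ.+-cancelʳ-≡ (toℕ i) k (suc m) (begin
  k + toℕ i                    ≡⟨ ℕₚ.m+[n∸m]≡n n≤ ⟨
  suc m + r                    ≡⟨ cong (suc m +_) r≡ ⟩
  suc m + toℕ i                ∎)) k<n
  where
  open ≡-Reasoning
  n≤ = ℕₚ.≮⇒≥ nlt
  r = k + toℕ i ∸ suc m
  r<n : r < suc m
  r<n = ℕₚ.+-cancelˡ-< (suc m) _ _ (subst (_< suc m + suc m) (sym (ℕₚ.m+[n∸m]≡n n≤)) (ℕₚ.+-mono-< k<n
    (Finₚ.toℕ<n i)))
  r≡ : r ≡ toℕ i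
  r≡ = begin
    r                   ≡⟨ DivMod.m<n⇒m%n≡m r<n ⟨
    r % suc m           ≡⟨ DivMod.[m+n]%n≡m%n r (suc m) ⟨
    (r + suc m) % suc m ≡⟨ cong (_% suc m) (ℕₚ.m∸n+n≡m n≤) ⟩
    (k + toℕ i) % suc m ≡⟨ toℕ-nxt^ k i ⟨
    toℕ (nxt^ k i)     ≡⟨ cong toℕ eq ⟩
    toℕ i               ∎

nxt^-+ : ∀ {m} a b (i : Fin (suc m)) → nxt^ (a + b) i ≡ nxt^ a (nxt^ b i)
nxt^-+ zero    b i = refl
nxt^-+ (suc a) b i = cong nxt (nxt^-+ a b i)

nxt^-injective : ∀ {m} a {i j : Fin (suc m)} → nxt^ a i ≡ nxt^ a j → i ≡ j
nxt^-injective zero    eq = eq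
nxt^-injective (suc a) eq = nxt^-injective a (nxt-injective eq)

nxt^-apart : ∀ {m} a b (i : Fin (suc m)) → a < b → b < a + suc m → nxt^ a i ≢ nxt^ b i
nxt^-apart {m} a b i a<b b<a+n eq =
  nxt^-≢ (b ∸ a) i (ℕₚ.m<n⇒0<n∸m a<b)
    (ℕₚ.+-cancelˡ-< a _ _ (subst (_< a + suc m) (sym (ℕₚ.m+[n∸m]≡n (ℕₚ.<⇒≤ a<b))) b<a+n))
    (nxt^-injective a (trans (sym (nxt^-+ a (b ∸ a) i)) (trans (cong (λ k → nxt^ k i) (ℕₚ.m+[n∸m]≡n
      (ℕₚ.<⇒≤ a<b))) (sym eq))))

-- Rotation, constant vectors and complement

shl : ∀ {n} → Cube n → Cube n
shl []      = []
shl (a ∷ x) = x ∷ʳ a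

lookup-∷ʳ-inject₁ : ∀ {n} (x : Cube n) a i → lookup (x ∷ʳ a) (inject₁ i) ≡ lookup x i
lookup-∷ʳ-inject₁ (b ∷ x) a zero    = refl
lookup-∷ʳ-inject₁ (b ∷ x) a (suc i) = lookup-∷ʳ-inject₁ x a i

lookup-∷ʳ-fromℕ : ∀ {n} (x : Cube n) a → lookup (x ∷ʳ a) (fromℕ n) ≡ a
lookup-∷ʳ-fromℕ []      a = refl
lookup-∷ʳ-fromℕ (b ∷ x) a = lookup-∷ʳ-fromℕ x a

lookup-shl : ∀ {m} (x : Cube (suc m)) i → lookup (shl x) i ≡ lookup x (nxt i)
lookup-shl (a ∷ x) i with view i
... | ‵fromℕ {m}  = trans (lookup-∷ʳ-fromℕ x a) (cong (lookup (a ∷ x)) (sym (nxt-fromℕ m)))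
... | ‵inject₁ i′ = trans (lookup-∷ʳ-inject₁ x a i′) (cong (lookup (a ∷ x)) (sym (nxt-inject₁ i′)))

cube-ext : ∀ {n} {x y : Cube n} → (∀ i → lookup x i ≡ lookup y i) → x ≡ y
cube-ext {x = x} {y} eq = trans (sym (Vecₚ.tabulate∘lookup x)) (trans (Vecₚ.tabulate-cong eq)
  (Vecₚ.tabulate∘lookup y))

d-∷ʳ : ∀ {n} (x y : Cube n) a b → d (x ∷ʳ a) (y ∷ʳ b) ≡ δ a b + d x y
d-∷ʳ []        []        a b = refl
d-∷ʳ (a′ ∷ x) (b′ ∷ y) a b = trans (cong (δ a′ b′ +_) (d-∷ʳ x y a b)) (x∙yz≈y∙xz (δ a′ b′) (δ a b) (d x y))

d-shl : ∀ {n} (x y : Cube n) → d (shl x) (shl y) ≡ d x y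
d-shl []      []      = refl
d-shl (a ∷ x) (b ∷ y) = d-∷ʳ x y a b

shl-injective : ∀ {n} {x y : Cube n} → shl x ≡ shl y → x ≡ y
shl-injective {x = x} {y} eq = d≡0⇒≡ x y (trans (sym (d-shl x y)) (trans (cong (d (shl x)) (sym eq)) (d-refl
  (shl x))))

K : ∀ {n} → Bool → Cube n
K c = replicate _ c

lookup-K : ∀ {n} (i : Fin n) c → lookup (K c) i ≡ c
lookup-K = Vecₚ.lookup-replicate

shl-K : ∀ {n} c → shl (K {n} c) ≡ K c
shl-K {zero}  c = refl
shl-K {suc n} c = cube-ext λ i → trans (lookup-shl (K {suc n} c) i) (trans (lookup-K (nxt i) c) (sym
  (lookup-K i c)))

shl-flip : ∀ {n} (a : Fin (suc n)) (x : Cube (suc n)) → shl (flip (nxt a) x) ≡ flip a (shl x)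
shl-flip a x = cube-ext λ i → trans (lookup-shl (flip (nxt a) x) i) (go i (i Finₚ.≟ a))
  where
  go : ∀ i → Dec (i ≡ a) → lookup (flip (nxt a) x) (nxt i) ≡ lookup (flip a (shl x)) i
  go i (yes refl) = trans (lookup-flip (nxt a) x) (trans (cong not (sym (lookup-shl x a))) (sym (lookup-flip a
    (shl x))))
  go i (no i≢a)   = trans (lookup-flip-≢ (i≢a ∘ nxt-injective) x) (trans (sym (lookup-shl x i)) (sym
    (lookup-flip-≢ i≢a (shl x))))

compl : ∀ {n} → Cube n → Cube n
compl = map not

lookup-compl : ∀ {n} (x : Cube n) i → lookup (compl x) i ≡ not (lookup x i)
lookup-compl x i = Vecₚ.lookup-map i not x

compl-compl : ∀ {n} (x : Cube n) → compl (compl x) ≡ x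
compl-compl []      = refl
compl-compl (a ∷ x) = cong₂ _∷_ (Boolₚ.not-involutive a) (compl-compl x)

d-compl : ∀ {n} (x y : Cube n) → d (compl x) (compl y) ≡ d x y
d-compl []      []      = refl
d-compl (a ∷ x) (b ∷ y) = cong₂ _+_ (δ-compl a b) (d-compl x y)
  where
  δ-compl : ∀ a b → δ (not a) (not b) ≡ δ a b
  δ-compl false false = refl
  δ-compl false true  = refl
  δ-compl true  false = refl
  δ-compl true  true  = refl

compl-shl : ∀ {n} (x : Cube n) → shl (compl x) ≡ compl (shl x)
compl-shl []      = refl
compl-shl (a ∷ x) = sym (Vecₚ.map-∷ʳ not a x)

compl-flip : ∀ {n} i (x : Cube n) → compl (flip i x) ≡ flip i (compl x)
compl-flip zero    (a ∷ x) = refl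
compl-flip (suc i) (a ∷ x) = cong (not a ∷_) (compl-flip i x)

compl-K : ∀ {n} c → compl (K {n} c) ≡ K (not c)
compl-K c = Vecₚ.map-replicate not c _

flip-comm : ∀ {n} {i j : Fin n} → i ≢ j → (x : Cube n) → flip i (flip j x) ≡ flip j (flip i x)
flip-comm {i = i} {j} i≢j x = Vecₚ.updateAt-commutes i j i≢j x

d-flip-flip : ∀ {n} {i j : Fin n} → i ≢ j → (x : Cube n) → d (flip i x) (flip j x) ≡ 2
d-flip-flip {i = zero}  {zero}  i≢j x       = contradiction refl i≢j
d-flip-flip {i = zero}  {suc j} _   (false ∷ x) = cong suc (d-flip j x)
d-flip-flip {i = zero}  {suc j} _   (true  ∷ x) = cong suc (d-flip j x)
d-flip-flip {i = suc i} {zero}  _   (false ∷ x) = cong suc (trans (d-sym (flip i x) x) (d-flip i x))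
d-flip-flip {i = suc i} {zero}  _   (true  ∷ x) = cong suc (trans (d-sym (flip i x) x) (d-flip i x))
d-flip-flip {i = suc i} {suc j} i≢j (a ∷ x) = cong₂ _+_ (δ-refl a) (d-flip-flip (i≢j ∘ cong suc) x)

-- The graph of layered cube vertices

Vertex : ℕ → Set
Vertex n = Bool × Cube n

-- This says that the codes under `enc` differ in two elements. Within a layer each changed
-- coordinate alters one spoke and one rim edge; across layers the spokes contribute d x y and the
-- rim edges d x (shl y). In the latter case the triangle inequality bounds d y (shl y) and d x (shl
-- x) by two, so both vectors change at most twice around the circle: hence the cyclic intervals.
data E {n} : Vertex n → Vertex n → Set where
  within : ∀ {ε x y} → Adj x y → E (ε , x) (ε , y)
  across : ∀ {x y} → d x y + d x (shl y) ≡ 2 → E (false , x) (true , y)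
  back   : ∀ {x y} → d x y + d x (shl y) ≡ 2 → E (true , y) (false , x)

E-sym : ∀ {n} {v w : Vertex n} → E v w → E w v
E-sym (within {x = x} {y} e) = within (adj-sym {x = x} {y} e)
E-sym (across e) = back e
E-sym (back e)   = across e

NonConst : ∀ {n} → Vertex n → Set
NonConst (_ , x) = x ≢ K false × x ≢ K true

cover-layer : ∀ {n} {P : Cube n → Set} {u v} ε → Cover Adj P u v →
              Cover E (λ (ε′ , y) → ε′ ≡ ε × P y) (ε , u) (ε , v)
cover-layer ε c = cover-resp (λ { (x , Px , refl) → refl , Px }) (λ { (refl , Py) → _ , Py , refl })
  (cover-map (ε ,_) (λ { _ _ refl → refl }) within c)

-- The automorphism of the base-cobase graph induced by the self-duality of the wheel.
Φ : ∀ {n} → Vertex n → Vertex n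
Φ (false , x) = true  , compl x
Φ (true  , y) = false , compl (shl y)

compl-injective : ∀ {n} {x y : Cube n} → compl x ≡ compl y → x ≡ y
compl-injective {x = x} {y} eq = trans (sym (compl-compl x)) (trans (cong compl eq) (compl-compl y))

Φ-injective : ∀ {n} {v w : Vertex n} → Φ v ≡ Φ w → v ≡ w
Φ-injective {v = false , _} {false , _} eq = cong (false ,_) (compl-injective (cong proj₂ eq))
Φ-injective {v = true  , _} {true  , _} eq = cong (true ,_) (shl-injective (compl-injective (cong proj₂ eq)))

-- On a code with spokes S and rim edges R both clauses of `Φ` act as (S , R) ↦ (R , shl S), a shift
-- of the alternating sequence of spokes and rim edges by one place. Such a shift preserves
-- distances.
Φ-E : ∀ {n} {v w : Vertex n} → E v w → E (Φ v) (Φ w)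
Φ-E (within {false} {x} {y} e) = within (trans (d-compl x y) e)
Φ-E (within {true}  {x} {y} e) = within (trans (d-compl (shl x) (shl y)) (trans (d-shl x y) e))
Φ-E (across {x} {y} e) = back (Φ-cross x y e)
  where
  Φ-cross : ∀ {n} (x y : Cube n) → d x y + d x (shl y) ≡ 2 →
            d (compl (shl y)) (compl x) + d (compl (shl y)) (shl (compl x)) ≡ 2
  Φ-cross x y e = begin
    d (compl (shl y)) (compl x) + d (compl (shl y)) (shl (compl x))
      ≡⟨ cong₂ _+_ (d-compl (shl y) x) (trans (cong (d (compl (shl y))) (compl-shl x)) (d-compl (shl y)
        (shl x))) ⟩
    d (shl y) x + d (shl y) (shl x)
      ≡⟨ cong₂ _+_ (d-sym (shl y) x) (trans (d-shl y x) (d-sym y x)) ⟩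
    d x (shl y) + d x y
      ≡⟨ ℕₚ.+-comm (d x (shl y)) (d x y) ⟩
    d x y + d x (shl y)
      ≡⟨ e ⟩
    2 ∎
    where open ≡-Reasoning
Φ-E (back e) = E-sym (Φ-E (across e))

cover-Φ : ∀ {n} {P : Vertex n → Set} {u v} → Cover E P u v →
          Cover E (λ w → ∃ λ w′ → P w′ × w ≡ Φ w′) (Φ u) (Φ v)
cover-Φ = cover-map Φ (λ _ _ → Φ-injective) Φ-E

shr : ∀ {m} → Cube (suc m) → Cube (suc m)
shr x = tabulate λ i → lookup x (prev i)

shl-shr : ∀ {m} (x : Cube (suc m)) → shl (shr x) ≡ x
shl-shr x = cube-ext λ i → trans (lookup-shl (shr x) i)
  (trans (Vecₚ.lookup∘tabulate (λ j → lookup x (prev j)) (nxt i)) (cong (lookup x) (prev-nxt i)))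

compl-≢K : ∀ {n} {x : Cube n} c → x ≢ K c → compl x ≢ K (not c)
compl-≢K c x≢ eq = x≢ (compl-injective (trans eq (sym (compl-K c))))

Φ⁻¹ : ∀ {m} → Vertex (suc m) → Vertex (suc m)
Φ⁻¹ (true  , y) = false , compl y
Φ⁻¹ (false , y) = true , shr (compl y)

Φ-Φ⁻¹ : ∀ {m} (v : Vertex (suc m)) → Φ (Φ⁻¹ v) ≡ v
Φ-Φ⁻¹ (true  , y) = cong (true ,_) (compl-compl y)
Φ-Φ⁻¹ (false , y) = cong (false ,_) (trans (cong compl (shl-shr (compl y))) (compl-compl y))

Φ-nonconst : ∀ {m} {v : Vertex (suc m)} → NonConst v → NonConst (Φ v)
Φ-nonconst {v = false , x} (≢0 , ≢1) = compl-≢K true ≢1 , compl-≢K false ≢0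
Φ-nonconst {v = true  , y} (≢0 , ≢1) = compl-≢K true (shl-≢K true ≢1) , compl-≢K false (shl-≢K false ≢0)
  where
  shl-≢K : ∀ {n} {x : Cube n} c → x ≢ K c → shl x ≢ K c
  shl-≢K c x≢ eq = x≢ (shl-injective (trans eq (sym (shl-K c))))

Φ⁻¹-nonconst : ∀ {m} {v : Vertex (suc m)} → NonConst v → NonConst (Φ⁻¹ v)
Φ⁻¹-nonconst {v = true  , y} (≢0 , ≢1) = compl-≢K true ≢1 , compl-≢K false ≢0
Φ⁻¹-nonconst {v = false , y} (≢0 , ≢1) = shr-≢K false (compl-≢K true ≢1) , shr-≢K true (compl-≢K false ≢0)
  where
  shr-≢K : ∀ {m} {x : Cube (suc m)} c → x ≢ K c → shr x ≢ K c
  shr-≢K {x = x} c x≢ eq = x≢ (trans (sym (shl-shr x)) (trans (cong shl eq) (shl-K c)))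

cover-Φ-nonconst : ∀ {m} {u v : Vertex (suc m)} → Cover E NonConst u v → Cover E NonConst (Φ u) (Φ v)
cover-Φ-nonconst c = cover-resp
  (λ { (w , nw , refl) → Φ-nonconst {v = w} nw }) (λ {w} nw → Φ⁻¹ w , Φ⁻¹-nonconst {v = w} nw , sym (Φ-Φ⁻¹ w))
    (cover-Φ c)

par-K : ∀ {n} → par (K {n} false) ≡ false
par-K {zero}  = refl
par-K {suc n} = par-K {n}

-- For c = false the flipped vectors are cyclic intervals of length one and two, for c = true their complements.
module _ {m : ℕ} (c : Bool) (a : Fin (suc (suc m))) where
  private
    k : Cube (suc (suc m))
    k = K c
    b : Fin (suc (suc m))
    b = nxt a

  nxt-≢ : nxt a ≢ a
  nxt-≢ = nxt^-≢ 1 a (s≤s z≤n) (s≤s (s≤s z≤n))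

  shl-single : shl (flip b k) ≡ flip a k
  shl-single = trans (shl-flip a k) (cong (flip a) (shl-K c))

  shl-double : shl (flip a (flip b k)) ≡ flip (prev a) (flip a k)
  shl-double = trans (cong (λ i → shl (flip i (flip b k))) (sym (nxt-prev a)))
                 (trans (shl-flip (prev a) (flip b k)) (cong (flip (prev a)) shl-single))

  cross-next : E (false , flip a k) (true , flip b k)
  cross-next = across (cong₂ _+_ (d-flip-flip (nxt-≢ ∘ sym) k) (trans (cong (d (flip a k)) shl-single) (d-refl
    (flip a k))))

  -- This edge and `cross-grow` change the parity, while `cross-next` and `cross-same` keep it.
  cross-shrink : E (false , flip a (flip b k)) (true , flip b k)
  cross-shrink = across (cong₂ _+_ (adj-sym {x = flip b k} {flip a (flip b k)} (d-flip a (flip b k)))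
    (trans (cong₂ d (flip-comm (nxt-≢ ∘ sym) k) shl-single) (adj-sym {x = flip a k} {flip b (flip a k)}
      (d-flip b (flip a k)))))

  cross-grow : E (false , flip a k) (true , flip a (flip b k))
  cross-grow = across (cong₂ _+_ (trans (cong (d (flip a k)) (flip-comm (nxt-≢ ∘ sym) k)) (d-flip b (flip a k)))
    (trans (cong (d (flip a k)) shl-double) (d-flip (prev a) (flip a k))))

cross-same : ∀ {m} c (a : Fin (suc (suc m))) → E (false , flip a (K c)) (true , flip a (K c))
cross-same c a = subst (λ i → E (false , flip i (K c)) (true , flip i (K c))) (nxt-prev a)
  (across (cong₂ _+_ (d-refl x) (trans (cong (d x) (shl-single c (prev a))) (d-flip-flip (nxt-≢ c (prev a))
    (K c)))))
  where x = flip (nxt (prev a)) (K c)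

separate-flip : ∀ {n} k (p u : Cube n) → u ≢ p → u ≢ flip k p → ∃ λ s → s ≢ k × lookup u s ≡ not (lookup p s)
separate-flip k p u u≢p u≢q =
  let s , qs , us = separate p (flip k p) u (d-flip k p) u≢p u≢q
  in s , (λ s≡k → b≢not (trans (sym (subst (λ i → lookup (flip k p) i ≡ lookup p i) s≡k qs))
    (lookup-flip k p))) , us

-- Hamiltonian paths of the halves around the zero vector

module Lower {m : ℕ} where

  n : ℕ
  n = suc (suc m)

  -- One facet of zeros per layer, cut at t in layer false and at t₁ in layer true. Such a facet
  -- never contains `K true`, so each layer has one hole.
  Low : Fin n → Fin n → Vertex n → Set
  Low t t₁ (false , y) = lookup y t  ≡ false × y ≢ K false
  Low t t₁ (true  , y) = lookup y t₁ ≡ false × y ≢ K false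

  e : Fin n → Cube n
  e i = flip i (K false)

  par-e : ∀ i → par (e i) ≡ true
  par-e i = trans (par-flip i (K false)) (cong not (par-K {n}))

  e≢0 : ∀ i → e i ≢ K false
  e≢0 i = par⇒≢ (trans (par-e i) (cong not (sym (par-K {n})))) ∘ sym

  e-off : ∀ {i j} → i ≢ j → lookup (e j) i ≡ false
  e-off {i} i≢j = trans (lookup-flip-≢ i≢j (K false)) (lookup-K i false)

  e-on : ∀ i → lookup (e i) i ≡ true
  e-on i = trans (lookup-flip i (K false)) (cong not (lookup-K i false))

  module _ (t t₁ : Fin n) (u γ : Cube n) (j : Fin n) (t≢i : t ≢ nxt j) (t₁≢i : t₁ ≢ nxt j)
           (ut : lookup u t ≡ false) (u≢0 : u ≢ K false) (u≢e : u ≢ e (nxt j))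
           (γt₁ : lookup γ t₁ ≡ false) (pγ : par γ ≡ true) (γ≢e : γ ≢ e (nxt j)) where
    private
      i : Fin n
      i = nxt j

    -- Without the even vertex `K false` the odd vertices of a facet are in excess by one, so both
    -- pieces must have odd ends. They meet at the singleton `e i`, which has a cross edge to its
    -- own copy.
    half-odd : par u ≡ true → Cover E (Low t t₁) (false , u) (true , γ)
    half-odd pu = cover-resp
      (λ { {false , _} (inj₁ (_ , y)) → y ; {true , _} (inj₂ (_ , y)) → y
         ; {true , _} (inj₁ (() , _)) ; {false , _} (inj₂ (() , _)) })
      (λ { {false , _} y → inj₁ (refl , y) ; {true , _} y → inj₂ (refl , y) })
      (cover-join
        (cover-layer false (miss₁-face t (lookup-K t false) ut (e-off t≢i)
          (trans pu (cong not (sym (par-K {n})))) (trans (par-e i) (sym pu)) u≢e))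
        (cross-same false i)
        (cover-layer true (miss₁-face t₁ (lookup-K t₁ false) (e-off t₁≢i) γt₁
          (trans (par-e i) (cong not (sym (par-K {n})))) (trans pγ (sym (par-e i))) (γ≢e ∘ sym)))
        (λ { (refl , _) (() , _) }))

    -- The vertex (false , e j), left out of the first piece for parity reasons, is visited between two
    -- vertices of layer true.
    half-even : t ≢ j → t₁ ≢ j → u ≢ flip j (e i) → γ ≢ e j → par u ≡ false →
                Cover E (Low t t₁) (false , u) (true , γ)
    half-even t≢j t₁≢j u≢f γ≢ej pu = cover-resp to from
      (cover-join
        (cover-layer false
          (miss₂-face t (lookup-K t false) (e-off t≢j) ut (e-off t≢i) (d-flip j (K false))
            (u≢0 , par⇒≢ (trans (par-e j) (cong not (sym pu))))
            (e≢0 i , flip-≢ i≢j (K false))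
            (trans (par-e i) (cong not (sym pu))) sepu))
        (cross-same false i)
        (cover-join (cover-single (true , e i)) (E-sym (cross-next false j))
          (cover-join (cover-single (false , e j)) (cross-grow false j)
            (cover-layer true
              (miss₂-face t₁ (lookup-K t₁ false) (e-off t₁≢i) (trans (lookup-flip-≢ t₁≢j (e i))
                (e-off t₁≢i)) γt₁
                (d-flip i (K false))
                (f≢0 , par⇒≢ (trans (par-e i) (cong not (sym pf))))
                (par⇒≢ (trans pγ (cong not (sym (par-K {n})))) ∘ sym , γ≢e)
                (trans pγ (cong not (sym pf))) sepγ))
            λ { refl (() , _) })
          λ { refl (inj₁ ()) ; refl (inj₂ (_ , _ , _ , ≢)) → ≢ refl })
        λ { (refl , _) (inj₁ ()) ; (refl , _ , _ , ≢) (inj₂ (inj₁ refl)) → ≢ refl ; (refl , _) (inj₂ (inj₂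
          (() , _))) })
      where
      i≢j : i ≢ j
      i≢j = nxt-≢ false j
      pf : par (flip j (e i)) ≡ false
      pf = trans (par-flip j (e i)) (cong not (par-e i))
      f≢0 : flip j (e i) ≢ K false
      f≢0 eq = contradiction (trans (sym (trans (lookup-flip j (e i)) (cong not (e-off (i≢j ∘ sym))))) (trans
        (cong (λ z → lookup z j) eq) (lookup-K j false))) λ ()
      γ≢f : γ ≢ flip j (e i)
      γ≢f = par⇒≢ (trans pγ (cong not (sym pf))) ∘ sym
      swap : flip i (flip j (e i)) ≡ e j
      swap = trans (flip-comm i≢j (e i)) (cong (flip j) (flip-flip i (K false)))
      -- The deleted edge from `K false` to `e j` has direction j, and u, being neither `e i` nor
      -- its flip along j, differs from `e i` in another direction. `sepγ` uses the same argument
      -- with direction i.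
      sepu : ∃ λ s → lookup (e j) s ≡ lookup (K false) s × lookup (e i) s ≡ not (lookup u s)
      sepu = let s , s≢j , us = separate-flip j (e i) u u≢e u≢f
             in s , lookup-flip-≢ s≢j (K false) , trans (sym (Boolₚ.not-involutive _)) (cong not (sym us))
      sepγ : ∃ λ s → lookup (e i) s ≡ lookup (K false) s × lookup γ s ≡ not (lookup (flip j (e i)) s)
      sepγ = let s , s≢i , γs = separate-flip i (flip j (e i)) γ γ≢f (λ eq → γ≢ej (trans eq swap))
             in s , lookup-flip-≢ s≢i (K false) , γs
      to : ∀ {z} → (proj₁ z ≡ false × lookup (proj₂ z) t ≡ false × Miss₂ (K false) (e j) (proj₂ z)) ⊎
                   (z ≡ (true , e i) ⊎ (z ≡ (false , e j) ⊎
                     (proj₁ z ≡ true × lookup (proj₂ z) t₁ ≡ false × Miss₂ (K false) (e i) (proj₂ z)))) →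
                       Low t t₁ z
      to (inj₁ (refl , yt , ≢0 , _))              = yt , ≢0
      to (inj₂ (inj₁ refl))                       = e-off t₁≢i , e≢0 i
      to (inj₂ (inj₂ (inj₁ refl)))                = e-off t≢j , e≢0 j
      to (inj₂ (inj₂ (inj₂ (refl , yt , ≢0 , _)))) = yt , ≢0
      from : ∀ {z} → Low t t₁ z → _
      from {false , y} (yt , ≢0) with y ≟ᶜ e j
      ... | yes refl = inj₂ (inj₂ (inj₁ refl))
      ... | no  ≢ej  = inj₁ (refl , yt , ≢0 , ≢ej)
      from {true , y} (yt , ≢0) with y ≟ᶜ e i
      ... | yes refl = inj₂ (inj₁ refl)
      ... | no  ≢ei  = inj₂ (inj₂ (inj₂ (refl , yt , ≢0 , ≢ei)))

    half : t ≢ j → t₁ ≢ j → u ≢ flip j (e i) → γ ≢ e j → Cover E (Low t t₁) (false , u) (true , γ)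
    half t≢j t₁≢j u≢f γ≢ej with par u in pu
    ... | true  = half-odd pu
    ... | false = half-even t≢j t₁≢j u≢f γ≢ej pu

-- Dimension at least five

module Large {m : ℕ} (5≤n : 5 ≤ suc (suc m)) where

  open Lower {m}

  N : Fin n → Fin n
  N = nxt

  -- Positions are named by their offset from o. Offsets that differ by less than five are distinct
  -- modulo n, and these bounds are checked by evaluation.
  apart : ∀ a b {lt : True (a ℕₚ.<? b)} {gt : True (b ℕₚ.<? a + 5)} {o : Fin n} → nxt^ a o ≢ nxt^ b o
  apart a b {lt} {gt} {o} = nxt^-apart a b o (toWitness lt)
    (ℕₚ.<-≤-trans (toWitness gt) (ℕₚ.+-monoʳ-≤ a 5≤n))

  ē : Fin n → Cube n
  ē i = flip i (K true)

  ē-off : ∀ {i j} → i ≢ j → lookup (ē j) i ≡ true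
  ē-off {i} i≢j = trans (lookup-flip-≢ i≢j (K true)) (lookup-K i true)

  ē-on : ∀ i → lookup (ē i) i ≡ false
  ē-on i = trans (lookup-flip i (K true)) (cong not (lookup-K i true))

  par-ē : ∀ i → par (ē i) ≡ not (par (K {n} true))
  par-ē i = par-flip i (K true)

  bits⇒≢ : ∀ {x y : Cube n} i {a} → lookup x i ≡ a → lookup y i ≡ not a → x ≢ y
  bits⇒≢ i xi yi refl = b≢not (trans (sym xi) yi)

  bit⇒≢K : ∀ {y : Cube n} i {a} → lookup y i ≡ a → y ≢ K (not a)
  bit⇒≢K i yi = bits⇒≢ i yi (lookup-K i _)

  clash : ∀ {b} → b ≡ true → b ≡ false → ⊥
  clash refl ()

  -- `half` forbids u to be `e (N j)` or the interval of j and N j. The bit of u at N (N q) selects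
  -- j: both forbidden vectors are zero there for j = q, and one there for j = N q.
  half-choice : ∀ (t t₁ : Fin n) (u γ : Cube n) q → lookup u t ≡ false → u ≢ K false → lookup γ t₁ ≡ false →
    par γ ≡ true →
                t ≢ q → t ≢ N q → t ≢ N (N q) → t₁ ≢ q → t₁ ≢ N q → t₁ ≢ N (N q) →
                γ ≢ e q → γ ≢ e (N q) → γ ≢ e (N (N q)) → Cover E (Low t t₁) (false , u) (true , γ)
  half-choice t t₁ u γ q ut u≢0 γt₁ pγ t≢q t≢Nq t≢NNq t₁≢q t₁≢Nq t₁≢NNq γ≢q γ≢Nq γ≢NNq with lookup u (N
    (N q)) in eq
  ... | true = half t t₁ u γ q t≢Nq t₁≢Nq ut u≢0
    (bits⇒≢ (N (N q)) eq (e-off (apart 1 2 ∘ sym))) γt₁ pγ γ≢Nq t≢q t₁≢q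
    (bits⇒≢ (N (N q)) eq (trans (lookup-flip-≢ (apart 0 2 ∘ sym) (e (N q))) (e-off (apart 1 2 ∘ sym)))) γ≢q
  ... | false = half t t₁ u γ (N q) t≢NNq t₁≢NNq ut u≢0
    (bits⇒≢ (N (N q)) eq (e-on (N (N q)))) γt₁ pγ γ≢NNq t≢Nq t₁≢Nq
    (bits⇒≢ (N (N q)) eq (trans (lookup-flip-≢ (apart 1 2 ∘ sym) (e (N (N q)))) (e-on (N (N q))))) γ≢Nq

  -- An exit from the lower half towards the all-ones side. As `half` wants an odd end, γ has n - 1
  -- ones if n is even and n - 2 if n is odd.
  record Gate (t₁ : Fin n) : Set where
    field
      γ     : Cube n
      off   : lookup γ t₁ ≡ false
      on    : ∀ {i} → i ≢ t₁ → i ≢ N t₁ → lookup γ i ≡ true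
      odd   : par γ ≡ true
      cross : E (true , γ) (false , ē t₁)

    ≢e : ∀ {i x} → i ≢ t₁ → i ≢ N t₁ → i ≢ x → γ ≢ e x
    ≢e i≢t₁ i≢Nt₁ i≢x = bits⇒≢ _ (on i≢t₁ i≢Nt₁) (e-off i≢x)

  gate : ∀ t₁ → Gate t₁
  gate t₁ with par (K {n} true) in eq
  ... | false = record
    { γ = ē t₁ ; off = ē-on t₁ ; on = λ i≢ _ → ē-off i≢
    ; odd = trans (par-ē t₁) (cong not eq) ; cross = E-sym (cross-same true t₁) }
  ... | true = record
    { γ = flip t₁ (ē (N t₁))
    ; off = trans (lookup-flip t₁ (ē (N t₁))) (cong not (ē-off (apart 0 1)))
    ; on = λ i≢ i≢N → trans (lookup-flip-≢ i≢ (ē (N t₁))) (ē-off i≢N)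
    ; odd = trans (par-flip t₁ (ē (N t₁))) (cong not (trans (par-ē (N t₁)) (cong not eq)))
    ; cross = E-sym (cross-grow true t₁) }

  -- Endpoints in the same layer

  same-layer-chain : ∀ {t t₁ s l u v γ z ζ} → t ≢ s → t₁ ≢ t → t₁ ≢ s → l ≢ t → l ≢ s → l ≢ t₁ →
    Cover E (Low t t₁) (false , u) (true , γ) → E (true , γ) (false , ē t₁) →
    E (true , ζ) (false , z) → lookup ζ t₁ ≡ true → ζ ≢ ē l → par ζ ≡ not (par (K {n} true)) →
    lookup z t ≡ true → lookup z s ≡ false → lookup v t ≡ true → lookup v s ≡ false → par v ≡ not (par z) →
    Cover E NonConst (false , u) (false , v)
  same-layer-chain {t} {t₁} {s} {l} {u} {v} {γ} {z} {ζ}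
    t≢s t₁≢t t₁≢s l≢t l≢s l≢t₁ low γ~ ζ~z ζt₁ ζ≢ pζ zt zs vt vs pv =
    -- The path must leave layer false and return to it. Its facet of ones is therefore cut again at
    -- s: the quarter with the hole `K true` is visited before the upper facet of layer true, and
    -- the quarter of v, a complete cube, comes last.
    cover-resp to from (cover-join low γ~ (cover-join c₁ (cross-same true l)
      (cover-join c₂ ζ~z c₃ disj₃) disj₂) disj₁)
    where
    P₁ P₂ P₃ : Vertex n → Set
    P₁ (ε , y) = ε ≡ false × lookup y t ≡ true × lookup y s ≡ true × y ≢ K true
    P₂ (ε , y) = ε ≡ true × lookup y t₁ ≡ true × y ≢ K true
    P₃ (ε , y) = ε ≡ false × lookup y t ≡ true × lookup y s ≡ false
    c₁ : Cover E P₁ (false , ē t₁) (false , ē l)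
    c₁ = cover-layer false (miss₁-face² t≢s (lookup-K t true) (ē-off (t₁≢t ∘ sym)) (ē-off (l≢t ∘ sym))
      (lookup-K s true) (ē-off (t₁≢s ∘ sym)) (ē-off (l≢s ∘ sym)) (par-ē t₁) (trans (par-ē l) (sym (par-ē t₁)))
      (flip-≢ (l≢t₁ ∘ sym) (K true)))
    c₂ : Cover E P₂ (true , ē l) (true , ζ)
    c₂ = cover-layer true (miss₁-face t₁ (lookup-K t₁ true) (ē-off (l≢t₁ ∘ sym)) ζt₁ (par-ē l)
      (trans pζ (sym (par-ē l))) (ζ≢ ∘ sym))
    c₃ : Cover E P₃ (false , z) (false , v)
    c₃ = cover-layer false (lace-face² t≢s zt vt zs vs pv)
    disj₃ : ∀ {y} → P₂ y → P₃ y → ⊥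
    disj₃ (refl , _) (() , _)
    disj₂ : ∀ {y} → P₁ y → P₂ y ⊎ P₃ y → ⊥
    disj₂ (refl , _)          (inj₁ (() , _))
    disj₂ (refl , _ , ys , _) (inj₂ (_ , _ , ys′)) = clash ys ys′
    disj₁ : ∀ {y} → Low t t₁ y → P₁ y ⊎ (P₂ y ⊎ P₃ y) → ⊥
    disj₁ {false , _} (yt , _) (inj₁ (_ , yt′ , _))        = clash yt′ yt
    disj₁ {true  , _} (yt , _) (inj₂ (inj₁ (_ , yt′ , _))) = clash yt′ yt
    disj₁ {false , _} (yt , _) (inj₂ (inj₂ (_ , yt′ , _))) = clash yt′ yt
    to : ∀ {y} → Low t t₁ y ⊎ (P₁ y ⊎ (P₂ y ⊎ P₃ y)) → NonConst y
    to {false , y} (inj₁ (yt , ≢0)) = ≢0 , bit⇒≢K t yt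
    to {true  , y} (inj₁ (yt , ≢0)) = ≢0 , bit⇒≢K t₁ yt
    to (inj₂ (inj₁ (refl , yt , _ , ≢1))) = bit⇒≢K t yt , ≢1
    to (inj₂ (inj₂ (inj₁ (refl , yt , ≢1)))) = bit⇒≢K t₁ yt , ≢1
    to (inj₂ (inj₂ (inj₂ (refl , yt , ys)))) = bit⇒≢K t yt , bit⇒≢K s ys
    from : ∀ {y} → NonConst y → Low t t₁ y ⊎ (P₁ y ⊎ (P₂ y ⊎ P₃ y))
    from {false , y} (≢0 , ≢1) with lookup y t | lookup y s
    ... | false | _     = inj₁ (refl , ≢0)
    ... | true  | true  = inj₂ (inj₁ (refl , refl , refl , ≢1))
    ... | true  | false = inj₂ (inj₂ (inj₂ (refl , refl , refl)))
    from {true , y} (≢0 , ≢1) with lookup y t₁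
    ... | false = inj₁ (refl , ≢0)
    ... | true  = inj₂ (inj₂ (inj₁ (refl , refl , ≢1)))

  -- The parity of z is dictated by v and that of ζ by the missing vertex K true; the cross edge preserves or
  -- changes parity as needed.
  exit : ∀ t t₁ s l (v : Cube n) → t ≢ s → t₁ ≢ s → l ≢ s → (N t ≡ s → t₁ ≢ N s × l ≢ N s) →
         ∃ λ z → ∃ λ ζ → E (true , ζ) (false , z) × lookup ζ t₁ ≡ true × ζ ≢ ē l × par ζ ≡ not (par
           (K {n} true)) ×
           lookup z t ≡ true × lookup z s ≡ false × par v ≡ not (par z)
  exit t t₁ s l v t≢s t₁≢s l≢s special with par v Boolₚ.≟ par (K {n} true)
  ... | yes pv = ē s , ē s , E-sym (cross-same true s) , ē-off t₁≢s , flip-≢ (l≢s ∘ sym) (K true) , par-ē s ,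
    ē-off t≢s , ē-on s , trans pv (trans (sym (Boolₚ.not-involutive _)) (cong not (sym (par-ē s))))
  -- Now z needs a second zero next to s. The place before s is preferred, as ζ is then `ē s`. If
  -- that place is t, where z must be one, the place after s is taken and ζ becomes `ē (N s)`; the
  -- hypothesis `special` serves this case.
  ... | no  pv with N t Finₚ.≟ s
  ... | yes refl = let t₁≢ , l≢ = special refl in
    flip s (ē (N s)) , ē (N s) , E-sym (cross-shrink true s) , ē-off t₁≢ , flip-≢ (l≢ ∘ sym) (K true) , par-ē
      (N s) ,
    trans (lookup-flip-≢ t≢s (ē (N s))) (ē-off (apart 0 2)) ,
    trans (lookup-flip s (ē (N s))) (cong not (ē-off (apart 1 2))) ,
    trans (Boolₚ.¬-not pv) (cong not (sym (trans (par-flip s (ē (N s))) (trans (cong not (par-ē (N s)))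
      (Boolₚ.not-involutive _)))))
  ... | no Nt≢s rewrite sym (nxt-prev s) = let σ = prev s in
    flip σ (ē (N σ)) , ē (N σ) , E-sym (cross-shrink true σ) , ē-off t₁≢s , flip-≢ (l≢s ∘ sym) (K true) , par-ē
      (N σ) ,
    trans (lookup-flip-≢ (Nt≢s ∘ cong N) (ē (N σ))) (ē-off t≢s) ,
    trans (lookup-flip-≢ (apart 0 1 ∘ sym) (ē (N σ))) (ē-on (N σ)) ,
    trans (Boolₚ.¬-not pv) (cong not (sym (trans (par-flip σ (ē (N σ))) (trans (cong not (par-ē (N σ)))
      (Boolₚ.not-involutive _)))))

  same-layer : ∀ o (let t = nxt^ 4 o) s (u v : Cube n) → u ≢ K false → lookup u t ≡ false →
               lookup v t ≡ true → lookup v s ≡ false → Cover E NonConst (false , u) (false , v)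
  same-layer o s u v u≢0 ut vt vs = go (s Finₚ.≟ nxt^ 3 o) (s Finₚ.≟ nxt^ 2 o)
    where
    t = nxt^ 4 o
    t≢s : t ≢ s
    t≢s refl = contradiction (trans (sym vt) vs) λ ()
    finish : ∀ t₁ l q → t₁ ≢ t → t₁ ≢ s → l ≢ t → l ≢ s → l ≢ t₁ → (N t ≡ s → t₁ ≢ N s × l ≢ N s) →
             t ≢ q → t ≢ N q → t ≢ N (N q) → t₁ ≢ q → t₁ ≢ N q → t₁ ≢ N (N q) → N q ≢ N t₁ → N (N q) ≢ N t₁ →
             Cover E NonConst (false , u) (false , v)
    finish t₁ l q t₁≢t t₁≢s l≢t l≢s l≢t₁ special t≢q t≢Nq t≢NNq t₁≢q t₁≢Nq t₁≢NNq Nq≢ NNq≢ =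
      let z , ζ , ζ~z , ζt₁ , ζ≢ , pζ , zt , zs , pv = exit t t₁ s l v t≢s t₁≢s l≢s special in
      same-layer-chain t≢s t₁≢t t₁≢s l≢t l≢s l≢t₁
        (half-choice t t₁ u γ q ut u≢0 off odd t≢q t≢Nq t≢NNq t₁≢q t₁≢Nq t₁≢NNq
          (≢e (t₁≢Nq ∘ sym) Nq≢ (apart 0 1 ∘ sym)) (≢e (t₁≢NNq ∘ sym) NNq≢ (apart 1 2 ∘ sym)) (≢e
            (t₁≢Nq ∘ sym) Nq≢ (apart 1 2)))
        cross ζ~z ζt₁ ζ≢ pζ zt zs vt vs pv
      where open Gate (gate t₁)
    go : Dec (s ≡ nxt^ 3 o) → Dec (s ≡ nxt^ 2 o) → Cover E NonConst (false , u) (false , v)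
    -- t₁ is a neighbour of t, which leaves three consecutive positions from q on outside both. The
    -- cases only make t₁ and l dodge s.
    go (yes refl) _ = finish (nxt^ 5 o) (nxt^ 2 o) (nxt^ 1 o)
      (apart 4 5 ∘ sym) (apart 3 5 ∘ sym) (apart 2 4) (apart 2 3) (apart 2 5) (λ eq → contradiction (sym eq)
        (apart 3 5))
      (apart 1 4 ∘ sym) (apart 2 4 ∘ sym) (apart 3 4 ∘ sym) (apart 1 5 ∘ sym) (apart 2 5 ∘ sym)
        (apart 3 5 ∘ sym)
      (apart 2 6) (apart 3 6)
    go (no s≢3) (yes refl) = finish (nxt^ 3 o) (nxt^ 1 o) o
      (apart 3 4) (apart 2 3 ∘ sym) (apart 1 4) (apart 1 2) (apart 1 3) (λ eq → contradiction (sym eq)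
        (apart 2 5))
      (apart 0 4 ∘ sym) (apart 1 4 ∘ sym) (apart 2 4 ∘ sym) (apart 0 3 ∘ sym) (apart 1 3 ∘ sym)
        (apart 2 3 ∘ sym)
      (apart 1 4) (apart 2 4)
    go (no s≢3) (no s≢2) = finish (nxt^ 3 o) (nxt^ 2 o) o
      (apart 3 4) (s≢3 ∘ sym) (apart 2 4) (s≢2 ∘ sym) (apart 2 3) (λ { refl → apart 3 6 , apart 2 6 })
      (apart 0 4 ∘ sym) (apart 1 4 ∘ sym) (apart 2 4 ∘ sym) (apart 0 3 ∘ sym) (apart 1 3 ∘ sym)
        (apart 2 3 ∘ sym)
      (apart 1 4) (apart 2 4)

  -- Endpoints in different layers

  High : Fin n → Fin n → Vertex n → Set
  High t t′ (false , y) = lookup y t  ≡ true × y ≢ K true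
  High t t′ (true  , y) = lookup y t′ ≡ true × y ≢ K true

  -- `Φ` carries `Low t′ (N t)` onto `High t t′`: complementing turns zeros into ones, and the
  -- rotation in layer true moves the cut from N t to t. Since `Φ` also exchanges the layers, the
  -- path is reversed.
  cover-high : ∀ {t t′ v γ} → Cover E (Low t′ (N t)) (false , compl v) (true , γ) →
               Cover E (High t t′) (false , compl (shl γ)) (true , v)
  cover-high {t} {t′} {v} {γ} c =
    cover-reverse E-sym (subst (λ w → Cover E (High t t′) (true , w) (false , compl (shl γ))) (compl-compl v)
      (cover-resp to from (cover-Φ c)))
    where
    to : ∀ {w} → (∃ λ w′ → Low t′ (N t) w′ × w ≡ Φ w′) → High t t′ w
    to ((false , x) , (xt , ≢0) , refl) = trans (lookup-compl x t′) (cong not xt) , compl-≢K false ≢0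
    to ((true  , y) , (yt , ≢0) , refl) =
      trans (lookup-compl (shl y) t) (cong not (trans (lookup-shl y t) yt)) ,
      compl-≢K false (λ eq → ≢0 (shl-injective (trans eq (sym (shl-K false)))))
    from : ∀ {w} → High t t′ w → ∃ λ w′ → Low t′ (N t) w′ × w ≡ Φ w′
    from {true  , y} (yt , ≢1) = (false , compl y) ,
      (trans (lookup-compl y t′) (cong not yt) , compl-≢K true ≢1) , cong (true ,_) (sym (compl-compl y))
    from {false , y} (yt , ≢1) = (true , shr (compl y)) ,
      (trans (sym (lookup-shl (shr (compl y)) t)) (trans (cong (λ z → lookup z t) (shl-shr (compl y))) (trans
        (lookup-compl y t) (cong not yt))) ,
       λ eq → compl-≢K true ≢1 (trans (sym (shl-shr (compl y))) (trans (cong shl eq) (shl-K false)))) ,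
      cong (false ,_) (trans (sym (compl-compl y)) (cong compl (sym (shl-shr (compl y)))))

  cross-layer-chain : ∀ {t t′ u v γ β} → Cover E (Low t t′) (false , u) (true , γ) → E (true , γ) (false , β) →
                      Cover E (High t t′) (false , β) (true , v) → Cover E NonConst (false , u) (true , v)
  cross-layer-chain {t} {t′} low γ~β high = cover-resp to from (cover-join low γ~β high disj)
    where
    disj : ∀ {y} → Low t t′ y → High t t′ y → ⊥
    disj {false , _} (yt , _) (yt′ , _) = clash yt′ yt
    disj {true  , _} (yt , _) (yt′ , _) = clash yt′ yt
    to : ∀ {y} → Low t t′ y ⊎ High t t′ y → NonConst y
    to {false , _} (inj₁ (yt , ≢0)) = ≢0 , bit⇒≢K t yt
    to {true  , _} (inj₁ (yt , ≢0)) = ≢0 , bit⇒≢K t′ yt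
    to {false , _} (inj₂ (yt , ≢1)) = bit⇒≢K t yt , ≢1
    to {true  , _} (inj₂ (yt , ≢1)) = bit⇒≢K t′ yt , ≢1
    from : ∀ {y} → NonConst y → Low t t′ y ⊎ High t t′ y
    from {false , y} (≢0 , ≢1) with lookup y t
    ... | false = inj₁ (refl , ≢0)
    ... | true  = inj₂ (refl , ≢1)
    from {true , y} (≢0 , ≢1) with lookup y t′
    ... | false = inj₁ (refl , ≢0)
    ... | true  = inj₂ (refl , ≢1)

  -- γ ends the lower half, and γ′ ends the other lower half whose image under `Φ` is the upper
  -- half; `cross` joins γ to the image of γ′. Both must be odd, so γ′ again depends on the parity
  -- of n.
  record Link (τ x : Fin n) (γ : Cube n) : Set where
    field
      γ′    : Cube n
      off   : lookup γ′ τ ≡ false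
      on    : ∀ {i} → i ≢ τ → i ≢ x → lookup γ′ i ≡ true
      odd   : par γ′ ≡ true
      cross : E (true , γ) (false , compl (shl γ′))

    ≢e : ∀ {i y} → i ≢ τ → i ≢ x → i ≢ y → γ′ ≢ e y
    ≢e i≢τ i≢x i≢y = bits⇒≢ _ (on i≢τ i≢x) (e-off i≢y)

  compl-shl-ē : ∀ t → compl (shl (ē (N t))) ≡ e t
  compl-shl-ē t = trans (cong compl (shl-single true t)) (trans (compl-flip t (K true)) (cong (flip t)
    (compl-K true)))

  compl-shl-double : ∀ t → compl (shl (flip t (ē (N t)))) ≡ flip (prev t) (e t)
  compl-shl-double t = trans (cong compl (shl-double true t)) (trans (compl-flip (prev t) (ē t))
    (cong (flip (prev t)) (trans (compl-flip t (K true)) (cong (flip t) (compl-K true)))))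

  link-next : ∀ t → Link (N t) (N (N t)) (e (N t))
  link-next t with par (K {n} true) in eq
  ... | false = record
    { γ′ = ē (N t) ; off = ē-on (N t) ; on = λ i≢ _ → ē-off i≢ ; odd = trans (par-ē (N t)) (cong not eq)
    ; cross = subst (λ b → E (true , e (N t)) (false , b)) (sym (compl-shl-ē t)) (E-sym (cross-next false t)) }
  ... | true = record
    { γ′ = flip (N t) (ē (N (N t)))
    ; off = trans (lookup-flip (N t) (ē (N (N t)))) (cong not (ē-off (apart 1 2)))
    ; on = λ i≢ i≢N → trans (lookup-flip-≢ i≢ (ē (N (N t)))) (ē-off i≢N)
    ; odd = trans (par-flip (N t) (ē (N (N t)))) (cong not (trans (par-ē (N (N t))) (cong not eq)))
    ; cross = subst (λ b → E (true , e (N t)) (false , b))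
        (sym (trans (compl-shl-double (N t)) (cong (λ i → flip i (e (N t))) (prev-nxt t))))
        (E-sym (cross-shrink false t)) }

  -- For layer true cut at a position other than t. If it is cut at t as well, `e t` is outside the
  -- lower half and `link-next` leaves from `e (N t)` instead.
  link-same : ∀ t → Link (N t) t (e t)
  link-same t with par (K {n} true) in eq
  ... | false = record
    { γ′ = ē (N t) ; off = ē-on (N t) ; on = λ i≢ _ → ē-off i≢ ; odd = trans (par-ē (N t)) (cong not eq)
    ; cross = subst (λ b → E (true , e t) (false , b)) (sym (compl-shl-ē t)) (E-sym (cross-same false t)) }
  ... | true = record
    { γ′ = flip t (ē (N t))
    ; off = trans (lookup-flip-≢ (apart 0 1 ∘ sym) (ē (N t))) (ē-on (N t))
    ; on = λ i≢N i≢ → trans (lookup-flip-≢ i≢ (ē (N t))) (ē-off i≢N)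
    ; odd = trans (par-flip t (ē (N t))) (cong not (trans (par-ē (N t)) (cong not eq)))
    ; cross = subst (λ b → E (true , e t) (false , b)) (sym (compl-shl-double t))
        (subst (λ s → E (true , e s) (false , flip (prev t) (e s))) (nxt-prev t) (E-sym (cross-shrink false
          (prev t)))) }

  cross-layer-incomparable : ∀ o (let t = nxt^ 4 o) u v → u ≢ K false → v ≢ K true →
                             lookup u t ≡ false → lookup v t ≡ true → Cover E NonConst (false , u) (true , v)
  cross-layer-incomparable o u v u≢0 v≢1 ut vt =
    cross-layer-chain
      (half-choice t t u (e (N t)) (nxt^ 1 o) ut u≢0 (e-off (apart 4 5)) (par-e (N t))
        4≢1 4≢2 4≢3 4≢1 4≢2 4≢3
        (flip-≢ (apart 1 5 ∘ sym) (K false)) (flip-≢ (apart 2 5 ∘ sym) (K false)) (flip-≢ (apart 3 5 ∘ sym)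
          (K false)))
      cross
      (cover-high (half-choice t (N t) (compl v) γ′ (nxt^ 1 o)
        (trans (lookup-compl v t) (cong not vt)) (compl-≢K true v≢1) off odd
        4≢1 4≢2 4≢3 (apart 1 5 ∘ sym) (apart 2 5 ∘ sym) (apart 3 5 ∘ sym)
        (≢e (apart 2 5) (apart 2 6) (apart 1 2 ∘ sym)) (≢e (apart 3 5) (apart 3 6) (apart 2 3 ∘ sym))
        (≢e (apart 2 5) (apart 2 6) (apart 2 3))))
    where
    t = nxt^ 4 o
    4≢1 = apart 1 4 {o = o} ∘ sym
    4≢2 = apart 2 4 {o = o} ∘ sym
    4≢3 = apart 3 4 {o = o} ∘ sym
    open Link (link-next t)

  -- A one of u outside j and N j tells u apart from both vectors that `half` forbids.
  half-witness : ∀ t t₁ (u γ : Cube n) j w → lookup u w ≡ true → w ≢ j → w ≢ N j →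
                 lookup u t ≡ false → u ≢ K false → lookup γ t₁ ≡ false → par γ ≡ true →
                 t ≢ j → t ≢ N j → t₁ ≢ j → t₁ ≢ N j → γ ≢ e j → γ ≢ e (N j) →
                 Cover E (Low t t₁) (false , u) (true , γ)
  half-witness t t₁ u γ j w uw w≢j w≢Nj ut u≢0 γt₁ pγ t≢j t≢Nj t₁≢j t₁≢Nj γ≢j γ≢Nj =
    half t t₁ u γ j t≢Nj t₁≢Nj ut u≢0 (bits⇒≢ w uw (e-off w≢Nj)) γt₁ pγ γ≢Nj t≢j t₁≢j
      (bits⇒≢ w uw (trans (lookup-flip-≢ w≢j (e (N j))) (e-off w≢Nj))) γ≢j

  -- No single cut has u below and v above. So layer false is cut at a zero t of u and layer true at
  -- a one t′ of v. By v ≤ u, t′ is also a one of u and t a zero of v, which supplies witnesses for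
  -- `half-witness`.
  cross-layer-below : ∀ o (let t = nxt^ 4 o) (u v : Cube n) → u ≢ K false → v ≢ K false → v ≢ K true →
    lookup u t ≡ false →
                      (∀ i → lookup v i ≡ true → lookup u i ≡ true) → Cover E NonConst (false , u) (true , v)
  cross-layer-below o u v u≢0 v≢0 v≢1 ut v≤u = go (lookup v (nxt^ 1 o) Boolₚ.≟ true)
    where
    t = nxt^ 4 o
    open Link (link-same t)
    vt : lookup v t ≢ true
    vt eq = contradiction (trans (sym ut) (v≤u t eq)) λ ()
    v̄≢0 : compl v ≢ K false
    v̄≢0 = compl-≢K true v≢1
    compl-on : ∀ {i} → lookup v i ≢ true → lookup (compl v) i ≡ true
    compl-on {i} ≢t = trans (lookup-compl v i) (cong not (Boolₚ.¬-not ≢t))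
    compl-off : ∀ {i} → lookup v i ≡ true → lookup (compl v) i ≡ false
    compl-off {i} eq = trans (lookup-compl v i) (cong not eq)
    low : ∀ t′ j → lookup v t′ ≡ true → t ≢ j → t ≢ N j → t′ ≢ j → t′ ≢ N j →
          Cover E (Low t t′) (false , u) (true , e t)
    low t′ j vt′ t≢j t≢Nj t′≢j t′≢Nj = half-witness t t′ u (e t) j t′ (v≤u t′ vt′) t′≢j t′≢Nj ut u≢0
      (e-off {t′} {t} λ { refl → vt vt′ }) (par-e t) t≢j t≢Nj t′≢j t′≢Nj (flip-≢ t≢j (K false)) (flip-≢ t≢Nj
        (K false))
    high : ∀ t′ j w → lookup v t′ ≡ true → lookup v w ≢ true → w ≢ j → w ≢ N j →
           t′ ≢ j → t′ ≢ N j → N t ≢ j → N t ≢ N j → γ′ ≢ e j → γ′ ≢ e (N j) →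
           Cover E (Low t′ (N t)) (false , compl v) (true , γ′)
    high t′ j w vt′ vw w≢j w≢Nj t′≢j t′≢Nj 5≢j 5≢Nj γ′≢j γ′≢Nj =
      half-witness t′ (N t) (compl v) γ′ j w (compl-on vw) w≢j w≢Nj (compl-off vt′) v̄≢0 off odd
        t′≢j t′≢Nj 5≢j 5≢Nj γ′≢j γ′≢Nj
    -- If v is one at offset 1, this is t′ and the pair of offsets 2, 3 suits both halves. Otherwise
    -- t′ is arbitrary and the pairs dodge it, with offset 1 as a zero of v that can witness the
    -- upper half.
    go : Dec (lookup v (nxt^ 1 o) ≡ true) → Cover E NonConst (false , u) (true , v)
    go (yes v1) = cross-layer-chain
      (low (nxt^ 1 o) (nxt^ 2 o) v1 (apart 2 4 ∘ sym) (apart 3 4 ∘ sym) (apart 1 2) (apart 1 3)) cross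
      (cover-high (high (nxt^ 1 o) (nxt^ 2 o) t v1 vt (apart 2 4 ∘ sym) (apart 3 4 ∘ sym) (apart 1 2)
        (apart 1 3)
        (apart 2 5 ∘ sym) (apart 3 5 ∘ sym)
        (≢e (apart 3 5) (apart 3 4) (apart 2 3 ∘ sym)) (≢e (apart 2 5) (apart 2 4) (apart 2 3))))
    go (no v1) = cross-layer-chain low′ cross (cover-high high′)
      where
      find = differ (K false) v (v≢0 ∘ sym)
      t′ = proj₁ find
      vt′ : lookup v t′ ≡ true
      vt′ = trans (proj₂ find) (cong not (lookup-K t′ false))
      t′≢1 : t′ ≢ nxt^ 1 o
      t′≢1 eq = v1 (subst (λ i → lookup v i ≡ true) eq vt′)
      t′≢4 : t′ ≢ t
      t′≢4 eq = vt (subst (λ i → lookup v i ≡ true) eq vt′)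
      low′ : Cover E (Low t t′) (false , u) (true , e t)
      low′ with t′ Finₚ.≟ nxt^ 2 o | t′ Finₚ.≟ nxt^ 3 o
      ... | no ≢2 | no ≢3 = low t′ (nxt^ 2 o) vt′ (apart 2 4 ∘ sym) (apart 3 4 ∘ sym) ≢2 ≢3
      ... | yes eq | _ = low t′ o vt′ (apart 0 4 ∘ sym) (apart 1 4 ∘ sym) (λ eq′ → apart 0 2 (trans
        (sym eq′) eq)) t′≢1
      ... | no _ | yes eq = low t′ o vt′ (apart 0 4 ∘ sym) (apart 1 4 ∘ sym) (λ eq′ → apart 0 3 (trans
        (sym eq′) eq)) t′≢1
      high′ : Cover E (Low t′ (N t)) (false , compl v) (true , γ′)
      high′ with t′ Finₚ.≟ nxt^ 3 o
      ... | no ≢3 = high t′ (nxt^ 3 o) (nxt^ 1 o) vt′ v1 (apart 1 3) (apart 1 4) ≢3 t′≢4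
        (apart 3 5 ∘ sym) (apart 4 5 ∘ sym) (≢e (apart 2 5) (apart 2 4) (apart 2 3)) (≢e (apart 2 5)
          (apart 2 4) (apart 2 4))
      ... | yes eq = high t′ (nxt^ 1 o) t vt′ vt (apart 1 4 ∘ sym) (apart 2 4 ∘ sym)
        t′≢1 (λ eq′ → apart 2 3 (trans (sym eq′) eq)) (apart 1 5 ∘ sym) (apart 2 5 ∘ sym)
        (≢e (apart 2 5) (apart 2 4) (apart 1 2 ∘ sym)) (≢e (apart 1 5) (apart 1 4) (apart 1 2))

  back⁴ : ∀ t → ∃ λ o → nxt^ 4 o ≡ t
  back⁴ t = prev (prev (prev (prev t))) ,
    trans (cong N (trans (cong N (trans (cong N (nxt-prev _)) (nxt-prev _))) (nxt-prev _))) (nxt-prev t)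

  layers-differ : ∀ u v → NonConst (false , u) → NonConst (true , v) → Cover E NonConst (false , u) (true , v)
  layers-differ u v (u≢0 , u≢1) (v≢0 , v≢1)
    with Finₚ.any? (λ t → (lookup u t Boolₚ.≟ false) ×-dec (lookup v t Boolₚ.≟ true))
  ... | yes (t , ut , vt) with o , refl ← back⁴ t = cross-layer-incomparable o u v u≢0 v≢1 ut vt
  ... | no none with t , ut ← differ (K true) u (u≢1 ∘ sym) with o , refl ← back⁴ t =
    cross-layer-below o u v u≢0 v≢0 v≢1 (trans ut (cong not (lookup-K (nxt^ 4 o) true)))
      λ i vi → Boolₚ.¬-not λ ui → none (i , ui , vi)

  layer-false : ∀ u v → NonConst (false , u) → NonConst (false , v) → u ≢ v → Cover E NonConst (false , u)
    (false , v)
  layer-false u v (u≢0 , u≢1) (v≢0 , v≢1) u≢v with differ u v u≢v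
  ... | t , vt with o , refl ← back⁴ t with lookup u (nxt^ 4 o) in ut
  ... | false = let s , vs = differ (K true) v (v≢1 ∘ sym) in
    same-layer o s u v u≢0 ut vt (trans vs (cong not (lookup-K s true)))
  ... | true  = let s , us = differ (K true) u (u≢1 ∘ sym) in
    cover-reverse E-sym (same-layer o s v u v≢0 vt ut (trans us (cong not (lookup-K s true))))

  connected : ∀ (u v : Vertex n) → NonConst u → NonConst v → u ≢ v → Cover E NonConst u v
  connected (false , u) (true  , v) nu nv u≢v = layers-differ u v nu nv
  connected (true  , u) (false , v) nu nv u≢v = cover-reverse E-sym (layers-differ v u nv nu)
  connected (false , u) (false , v) nu nv u≢v = layer-false u v nu nv (u≢v ∘ cong (false ,_))
  connected (true  , u) (true  , v) (u≢0 , u≢1) (v≢0 , v≢1) u≢v =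
    subst₂ (λ x y → Cover E NonConst (true , x) (true , y)) (compl-compl u) (compl-compl v)
      (cover-Φ-nonconst (layer-false (compl u) (compl v)
        (compl-≢K true u≢1 , compl-≢K false u≢0) (compl-≢K true v≢1 , compl-≢K false v≢0)
        (u≢v ∘ cong (true ,_) ∘ compl-injective)))

-- Dimensions three and four

_≟ᵛ_ : ∀ {n} (v w : Vertex n) → Dec (v ≡ w)
_≟ᵛ_ = Productₚ.≡-dec Boolₚ._≟_ _≟ᶜ_

E? : ∀ {n} (v w : Vertex n) → Dec (E v w)
E? (false , x) (false , y) = map′ within (λ { (within e) → e }) (d x y ℕₚ.≟ 1)
E? (true  , x) (true  , y) = map′ within (λ { (within e) → e }) (d x y ℕₚ.≟ 1)
E? (false , x) (true  , y) = map′ across (λ { (across e) → e }) (d x y + d x (shl y) ℕₚ.≟ 2)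
E? (true  , y) (false , x) = map′ back (λ { (back e) → e }) (d x y + d x (shl y) ℕₚ.≟ 2)

path? : ∀ {n} (u v : Vertex n) l → Dec (Path E u v l)
path? u v []          = no λ ()
path? u v (x ∷ [])    = map′ (λ { (refl , refl) → stop x }) (λ { (stop _) → refl , refl }) ((u ≟ᵛ x) ×-dec
  (v ≟ᵛ x))
path? u v (x ∷ y ∷ l) = map′ (λ { (refl , e , p) → step e p })
  (λ { (step e p@(stop _)) → refl , e , p ; (step e p@(step _ _)) → refl , e , p })
  ((u ≟ᵛ x) ×-dec (E? u y ×-dec path? y v (y ∷ l)))

nonConst? : ∀ {n} (v : Vertex n) → Dec (NonConst v)
nonConst? (_ , x) = ¬? (x ≟ᶜ K false) ×-dec ¬? (x ≟ᶜ K true)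

cubes : ∀ n → List (Cube n)
cubes zero    = [] ∷ []
cubes (suc n) = cartesianProductWith _∷_ (false ∷ true ∷ []) (cubes n)

∈-bools : ∀ b → b ∈ false ∷ true ∷ []
∈-bools false = here refl
∈-bools true  = there (here refl)

∈-cubes : ∀ {n} (x : Cube n) → x ∈ cubes n
∈-cubes []      = here refl
∈-cubes (a ∷ x) = ∈-cartesianProductWith⁺ _∷_ (∈-bools a) (∈-cubes x)

vertices : ∀ n → List (Vertex n)
vertices n = cartesianProduct (false ∷ true ∷ []) (cubes n)

∈-vertices : ∀ {n} (v : Vertex n) → v ∈ vertices n
∈-vertices (ε , x) = ∈-cartesianProduct⁺ (∈-bools ε) (∈-cubes x)

module _ {n : ℕ} where
  open DecUnique (_≟ᵛ_ {n}) using (unique?)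
  open DecMembership (_≟ᵛ_ {n}) using (_∈?_)

  IsCover : Vertex n → Vertex n → List (Vertex n) → Set
  IsCover u v l = Path E u v l × Unique l × All NonConst l × All (λ w → NonConst w → w ∈ l) (vertices n)

  isCover? : ∀ u v l → Dec (IsCover u v l)
  isCover? u v l = path? u v l ×-dec unique? l ×-dec all? nonConst? l ×-dec
    all? (λ w → nonConst? w →-dec (w ∈? l)) (vertices n)

  isCover⇒cover : ∀ {u v l} → IsCover u v l → Cover E NonConst u v
  isCover⇒cover (p , uni , s , c) = cover p uni (All.lookup s) (λ {w} → All.lookup c (∈-vertices w))

-- Two hexadecimal digits per vertex, the layer and then the bits of the cube vertex; the last two digits come
-- first.
decodeCube : ∀ n → ℕ → Cube n
decodeCube zero    _ = []
decodeCube (suc n) c = (c % 2 ≡ᵇ 1) ∷ decodeCube n (c / 2)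

-- The number of vertices is an argument because leading zero digits are lost in a number.
decode : ∀ n → ℕ → ℕ → List (Vertex n)
decode n zero    _ = []
decode n (suc k) c = ((c / 16 % 2 ≡ᵇ 1) , decodeCube n (c % 16)) ∷ decode n k (c / 256)

-- With the target fixed and all sources allowed, the property is invariant under `Φ`, so one target
-- per orbit is enough.
Reaches : ∀ {n} → Vertex n → Set
Reaches u = ∀ v → NonConst v → v ≢ u → Cover E NonConst v u

reaches-Φ : ∀ {m} {u : Vertex (suc m)} → Reaches u → Reaches (Φ u)
reaches-Φ {u = u} r v nv v≢ = subst (λ w → Cover E NonConst w (Φ u)) (Φ-Φ⁻¹ v)
  (cover-Φ-nonconst (r (Φ⁻¹ v) (Φ⁻¹-nonconst {v = v} nv) λ { refl → v≢ (sym (Φ-Φ⁻¹ v)) }))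

Φ^ : ∀ {n} → ℕ → Vertex n → Vertex n
Φ^ zero    v = v
Φ^ (suc k) v = Φ (Φ^ k v)

reaches-Φ^ : ∀ {m} k {u : Vertex (suc m)} → Reaches u → Reaches (Φ^ k u)
reaches-Φ^ zero    r = r
reaches-Φ^ (suc k) r = reaches-Φ (reaches-Φ^ k r)

module Certificate (m size : ℕ) where

  n : ℕ
  n = suc m

  Certified : Vertex n × List ℕ → Set
  Certified (u , codes) = All (λ v → NonConst v → v ≢ u → Any (λ c → IsCover v u (decode n size c)) codes)
    (vertices n)

  certified? : ∀ p → Dec (Certified p)
  certified? (u , codes) = all? (λ v → nonConst? v →-dec (¬? (v ≟ᵛ u) →-dec any? (λ c → isCover? v u
    (decode n size c)) codes)) (vertices n)

  -- `Φ` applied twice is `shl` on either layer, so its 2n-th power is the identity and the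
  -- exponents below n + n exhaust an orbit.
  Orbits : List (Vertex n × List ℕ) → Set
  Orbits ps = All (λ v → NonConst v → Any (λ p → Any (λ k → Φ^ k (proj₁ p) ≡ v) (upTo (n + n))) ps) (vertices n)

  orbits? : ∀ ps → Dec (Orbits ps)
  orbits? ps = all? (λ v → nonConst? v →-dec any? (λ p → any? (λ k → Φ^ k (proj₁ p) ≟ᵛ v) (upTo (n + n))) ps)
    (vertices n)

  certified⇒reaches : ∀ {p} → Certified p → Reaches (proj₁ p)
  certified⇒reaches cert v nv v≢u = isCover⇒cover (proj₂ (Any.satisfied (All.lookup cert
    (∈-vertices v) nv v≢u)))

  connected : ∀ ps → True (all? certified? ps) → True (orbits? ps) →
              ∀ (u v : Vertex n) → NonConst u → NonConst v → u ≢ v → Cover E NonConst u v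
  connected ps cert orb u v nu nv u≢v =
    go (All.lookup (toWitness {a? = orbits? ps} orb) (∈-vertices v) nv)
      (toWitness {a? = all? certified? ps} cert)
    where
    go : ∀ {ps} → Any (λ p → Any (λ k → Φ^ k (proj₁ p) ≡ v) (upTo (n + n))) ps → All Certified ps →
      Cover E NonConst u v
    go (here orbit) (c ∷ _) with k , refl ← Any.satisfied orbit = reaches-Φ^ k (certified⇒reaches c) u nu u≢v
    go (there i)    (_ ∷ cs) = go i cs

paths3 : List (Vertex 3 × List ℕ)
paths3 =
  ((false , false ∷ false ∷ true ∷ []) ,
    0x040515111301031216140602 ∷ 0x041511051301031202141606 ∷ 0x040511150616140212130301 ∷ 0x040602121311010316141505 ∷
    0x041416020615110501131203 ∷ 0x041101121602031305150614 ∷ 0x040602031614151105130112 ∷ 0x040614150511130301120216 ∷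
    0x040501121303021606141511 ∷ 0x041406021612030111130515 ∷ 0x041416030206151105011213 ∷
    []) ∷
  ((false , false ∷ true ∷ true ∷ []) ,
    0x061505011113031612021404 ∷ 0x061614150405110113031202 ∷ 0x061402031612130515041101 ∷ 0x060216120301131104141505 ∷
    0x060405151113011202141603 ∷ 0x061511040501130312160214 ∷ 0x061505131104140216030112 ∷ 0x060214150504110113120316 ∷
    0x060414160212130301051511 ∷ 0x060216120103130511041415 ∷ 0x060212031614150411010513 ∷
    []) ∷
  []

-- The four orbits have sizes 8, 8, 4 and 8; the alternating vector has the short one, being fixed
-- by two rotations.
paths4 : List (Vertex 4 × List ℕ)
paths4 =
  ((false , false ∷ false ∷ false ∷ true ∷ []) ,
    0x08090b03131707050111151d0d1b1a18190c0e0a021216061e1c1404 ∷ 0x080911151402120113031617071e061c1d190d0504181a1b0b0a0e0c ∷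
    0x0811191b090b0a0e0c0d1d151716120313010507061e1a181c041402 ∷ 0x080911191b0d050716031301120214060e1e1a180c041c1d15170b0a ∷
    0x080c181c1d1511090b13010312020a0e1e1a1b190d05071716140406 ∷ 0x080a0b1b131707160301091911151d0d05040c181a120214061e1c0e ∷
    0x080a0e1d151404050d1b091311190c181a120216061c1e07170b0301 ∷ 0x08111514060e0a0b1b131716120203071e1a18041c0c191d0d050109 ∷
    0x08181c1e07170b0a0e1d151113010316061402121a1b19090d0c0405 ∷ 0x081109010312160705040c1d19181a1e0e0a02061c1415170b131b0d ∷
    0x080c0d05040614151d1c1819090b170716120111131b1a1e0e0a0203 ∷ 0x080a0e061404181a1e16030212010507171511191d1c0c0d091b130b ∷
    0x0811151d0d050109191b1a181c0c041406161e0e0a021213170b0307 ∷ 0x080c1c04050d1b191d0e0a0212010317130b091115140607161e1a18 ∷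
    0x080a0b090d0c191b131203161707050111151d0e1e1a181c04060214 ∷ 0x08180c0d050103020a0b17151113091b191d0e1e1a1216070604141c ∷
    0x08090b1311010504181a1b0d190c1d1517161406020a0e1c1e070312 ∷ 0x0811190c1d0e1e06070504181c1415171612020a0b130301090d1b1a ∷
    0x080911191d0d05070301131b0b171514020a0e1e061c040c181a1216 ∷ 0x08190c181a1b0d0911130b17151d1c061612010307050414020a0e1e ∷
    0x080a0b091b1a1e07050d1d19180c0e1c040614151716020312011311 ∷ 0x0811091b1a120301050d1d1517130b0a020616071e0e1c14040c1819 ∷
    0x081101121602031707050d1d191b09130b0a0e061e1a180c041c1415 ∷ 0x080a02030b131101091b19180c0d0504141517070616121a1e1c0e1d ∷
    0x08190c1c04181a1e0e1d0d0507171511011203160614020a0b091b13 ∷ 0x0811151d19180c1c040607031317161402121a1e0e0a0b0901050d1b ∷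
    0x08180c1c0406140203161e1a1201091311151d0e0a0b1b190d050717 ∷
    []) ∷
  ((false , false ∷ false ∷ true ∷ true ∷ []) ,
    0x0c1c0e1d191b0d0504181a1e1614151101090b031213170706020a08 ∷ 0x0c0d1d15141c0e0a02121a1e16060703170b1b191808091113010504 ∷
    0x0c04050d0913011119080a0b1b1a181c14151d0e1e06071716120302 ∷ 0x0c0d0501130b1b09111908181a121606070317151d0e1e1c0414020a ∷
    0x0c1c1e1617130b03070504181a1201090d1b191d0e0a081115140206 ∷ 0x0c080a021612030b091911011317151d0d1b1a180405071e1c14060e ∷
    0x0c1c0e1d0d05040616141517071e1a1b1918080911130b0a02120301 ∷ 0x0c0e1d190d1b1a1e16061c180414020a081115170705010312130b09 ∷
    0x0c0e0a0b17151d0d091b131216070301111908181a1e1c1402060405 ∷ 0x0c1c1404181a1e0e0a0206070501030b090811191d15171612131b0d ∷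
    0x0c0e0a02121a1808090d1b191d1c14040507061e1617151101130b03 ∷ 0x0c081101031715141607060212131b0919181a1e1c04050d1d0e0a0b ∷
    0x0c191808110112031317151404050d090b1b1a1e061c1d0e0a021607 ∷ 0x0c19090b0a0e1e060214151716030705041c1d0d1b1a120113110818 ∷
    0x0c1d0e06160705041c1e1a1b130302120111090d1918080a0b171514 ∷ 0x0c180414060212161e1a1b0b0a0811151713010307050d09191d0e1c ∷
    0x0c0d050111130b1b0919080a0e1e07160614020317151d1c04181a12 ∷ 0x0c190811091b0d05010312020a0b131707060e1d1514161e1c04181a ∷
    0x0c1908181c04050d1d0e1e1a1b0901111514020a0b17131203070616 ∷ 0x0c041402030b171301091b0d050716121a18191d1511080a0e061c1e ∷
    0x0c04050d1d151713121602141c1e1a1b191808090b0a0e0607030111 ∷ 0x0c1d0e0a0b131108181c061e1a1b0901121602030717151404050d19 ∷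
    0x0c191d0d091b0b1303121606020a0e1c140405011108181a1e071715 ∷ 0x0c0e0604181c1e1a120109080a0b131b0d050716170302141511191d ∷
    0x0c1c04050d091b0b0301121a1e07161406020a0e1d19180811151713 ∷ 0x0c0d19111514040501091312030b1707161e0e1d1c06020a08181a1b ∷
    0x0c0d1d1511080a021404060e1c1e1603130b091b19181a1201050717 ∷
    []) ∷
  ((false , false ∷ true ∷ false ∷ true ∷ []) ,
    0x0a0b1b13090111151703121a180c1c1e070504141602060e1d0d1908 ∷ 0x0a0811090b1b1a1e0e1c0c1d1517160307061402121301050d191804 ∷
    0x0a020301090d191b0b131216141c0604050717151108181a1e0e1d0c ∷ 0x0a0e1d0c08191115170b090d0501131b1a121603071e0604181c1402 ∷
    0x0a0e1e07160302141c0c18191b1a12130b17151d0d09081101050406 ∷ 0x0a08181a120203170b09131b190d050111151d0c1c04061416071e0e ∷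
    0x0a0b1703070504061c181a1e0e0c0819091b0d1d1514160212131101 ∷ 0x0a02121a1e16141c060e0c0d1d15170705041808191b130b03011109 ∷
    0x0a0b09081115140203011213170716060e1d0c18041c1e1a1b190d05 ∷ 0x0a02120111090b131707031614151d191b1a1e060e0c08181c04050d ∷
    0x0a0e0c181c1d0d0501130b091b1908111514040602121a1e07171603 ∷ 0x0a021404060e1e1c1808190c1d1511010507171603121a1b0d09130b ∷
    0x0a02161e1a1b0d050112130b031715141c0418191109080c1d0e0607 ∷ 0x0a0e1d15141c0602121a1e1607170b03131b190d0908110105040c18 ∷
    0x0a0e1c0604050103131b1a1202161e07170b091108180c0d191d1514 ∷ 0x0a0e1e1a1b0b0302120113090d050418080c1d19111517071606141c ∷
    0x0a08111517130b1b191d0c0e1e071606020301090d0504141c181a12 ∷ 0x0a0809010507170b0316120214040c0d1d1511131b19181c060e1e1a ∷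
    0x0a0e0c1d1c0405071e060214151713030b1b1a1808190d0911011216 ∷ 0x0a02121a180c08110113030b091b190d05041415170716061c1d0e1e ∷
    0x0a0214060716030b17151d1c04050113121a1e0e0c0d1b1918080911 ∷ 0x0a0b17070313120216061e1a1b0d05010908111514041c0e1d0c1819 ∷
    0x0a081911011213090b031707050d1b1a180c04060e1d1c1e16021415 ∷ 0x0a08181a1201031602061e07050d190911131b0b171514041c0c0e1d ∷
    0x0a080c0e1e1c1d15111918041416020607050d090b170301121a1b13 ∷ 0x0a0e061402121a1e071617151d0c1c18040501030b13090811190d1b ∷
    0x0a021213030b1b1a1e0e061c180414151d0d09190c08110105071617 ∷
    []) ∷
  ((false , false ∷ true ∷ true ∷ true ∷ []) ,
    0x0e1c1e16020a0b17030111191b1a1213090d0c1d1514060705041808 ∷ 0x0e0a0b1b190c1c1416071e0602121a180811090d1d15170313010504 ∷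
    0x0e1e1a1203020a08090111130b1b0d050716171514060418191d1c0c ∷ 0x0e0a0b091108191d1514061e1a1203010504181c0c0d1b1317071602 ∷
    0x0e1e061402160705040c0d0901111908181c1d15170313121a1b0b0a ∷ 0x0e1d190c08181a12160301130b0a021404050d1b09111517071e1c06 ∷
    0x0e1c1e07050d0c041406020a080911130b1b1a18191d151716031201 ∷ 0x0e1e0716120214151713030b0a08191b1a181c06040c1d0d05011109 ∷
    0x0e1d0d0c080a021203171301090b1b1a1e0716061c18191115140405 ∷ 0x0e1d0c181a1b130911151402061e1c04050112030716170b0a08190d ∷
    0x0e0a08090b1b1911151d0d0c180406070501131716121a1e1c140203 ∷ 0x0e06071e1a1b13031201050d1d1c0414151109190c18080a0216170b ∷
    0x0e1d0c19181a12131115170b1b0d09080a02061e1c14040501031607 ∷ 0x0e061e1c0c0d050414021607030111080a0b17151d191b0913121a18 ∷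
    0x0e0a0b0317071e16020604050d190c08091b131101121a181c1d1514 ∷ 0x0e061e07050418080a0b13171602141511090103121a1b0d0c191d1c ∷
    0x0e1c1d0c0d1918081115170b0a02031301091b1a1e06140405071612 ∷ 0x0e1c18040c0811091b191d0d050703130112161415170b0a02061e1a ∷
    0x0e0c18080a0b03021201050414151d1c060717131109190d1b1a1e16 ∷ 0x0e0604141607050111080c0d091b19181a12020a0b031317151d1c1e ∷
    0x0e061c1d151404180c0d191b1a1e161213170b0a0203070501090811 ∷ 0x0e1c1e1a1808091b0b0a02061614040c1d1511011213170307050d19 ∷
    0x0e0a081819111317071e0604141602030b091b1a1201050d0c1c1d15 ∷ 0x0e0c0d091119080a0203011216141517130b1b1a1e06070504181c1d ∷
    0x0e0c1c181a1201050414151d0d191b0b1703071e0616020a08091113 ∷ 0x0e0c1911090d0504061e0716170301130b0a08181c1d151402121a1b ∷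
    0x0e1e16121a180c1c1d15140406020a080919110113030b1b0d050717 ∷
    []) ∷
  []

connected₃ : ∀ (u v : Vertex 3) → NonConst u → NonConst v → u ≢ v → Cover E NonConst u v
-- 12 = 2(2³ - 2) counts the nonconstant vertices; for n = 4 it is 28 = 2(2⁴ - 2).
connected₃ = Certificate.connected 2 12 paths3 _ _

connected₄ : ∀ (u v : Vertex 4) → NonConst u → NonConst v → u ≢ v → Cover E NonConst u v
connected₄ = Certificate.connected 3 28 paths4 _ _

nxt^-n : ∀ {m} (i : Fin (suc m)) → nxt^ (suc m) i ≡ i
nxt^-n {m} i = Finₚ.toℕ-injective (begin
  toℕ (nxt^ (suc m) i)    ≡⟨ toℕ-nxt^ (suc m) i ⟩
  (suc m + toℕ i) % suc m ≡⟨ trans (cong (_% suc m) (ℕₚ.+-comm (suc m) (toℕ i))) (DivMod.[m+n]%n≡m%n (toℕ i)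
    (suc m)) ⟩
  toℕ i % suc m           ≡⟨ DivMod.m<n⇒m%n≡m (Finₚ.toℕ<n i) ⟩
  toℕ i                   ∎)
  where open ≡-Reasoning

nxt^-nxt : ∀ {m} k (i : Fin (suc m)) → nxt^ k (nxt i) ≡ nxt (nxt^ k i)
nxt^-nxt zero    i = refl
nxt^-nxt (suc k) i = cong nxt (nxt^-nxt k i)

reach : ∀ {m} (a i : Fin (suc m)) → ∃ λ k → k < suc m × nxt^ k a ≡ i
reach {m} a i = k , DivMod.m%n<n (toℕ i + (suc m ∸ toℕ a)) (suc m) , Finₚ.toℕ-injective (begin
  toℕ (nxt^ k a)                                 ≡⟨ toℕ-nxt^ k a ⟩
  (k + toℕ a) % n                                ≡⟨ DivMod.%-distribˡ-+ k (toℕ a) n ⟩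
  (k % n + toℕ a % n) % n                        ≡⟨ cong (λ x → (x + toℕ a % n) % n) (DivMod.m%n%n≡m%n (toℕ i +
    (n ∸ toℕ a)) n) ⟩
  (k + toℕ a % n) % n                            ≡⟨ DivMod.%-distribˡ-+ (toℕ i + (n ∸ toℕ a)) (toℕ a) n ⟨
  (toℕ i + (n ∸ toℕ a) + toℕ a) % n              ≡⟨ cong (_% n) (ℕₚ.+-assoc (toℕ i) (n ∸ toℕ a) (toℕ a)) ⟩
  (toℕ i + (n ∸ toℕ a + toℕ a)) % n              ≡⟨ cong (λ x → (toℕ i + x) % n) (ℕₚ.m∸n+n≡m (ℕₚ.<⇒≤
    (Finₚ.toℕ<n a))) ⟩
  (toℕ i + n) % n                                ≡⟨ DivMod.[m+n]%n≡m%n (toℕ i) n ⟩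
  toℕ i % n                                      ≡⟨ DivMod.m<n⇒m%n≡m (Finₚ.toℕ<n i) ⟩
  toℕ i                                          ∎)
  where
  open ≡-Reasoning
  n = suc m
  k = (toℕ i + (n ∸ toℕ a)) % n

-- Forests

module _ (G : Graph) (I : Subset (nE G)) (Par : Fin (nV G) → Fin (nV G) → Set) (h : Fin (nV G) → ℕ)
         (functional : ∀ {x y z} → Par x y → Par x z → y ≡ z)
         (descend : ∀ {x y} → Par x y → h y < h x)
         (oriented : ∀ {x y} → AdjIn G I x y → Par x y ⊎ Par y x) where

  -- Once a cycle walks away from the roots it can never turn back, so h would grow for ever;
  -- and it cannot walk towards the roots for ever.
  forest-independent : Independent G I
  forest-independent (suc k , 3≤k , f , inj , adj) = [ absurd-up , absurd-down ]′ (walk (suc k))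
    where
    f-adj : ∀ j → AdjIn G I (f j) (f (nxt j))
    f-adj j = subst (λ i → AdjIn G I (f j) (f i)) (sym (nxt≡next j)) (adj j)
    Up : Fin (suc k) → Set
    Up j = Par (f (nxt j)) (f j)
    up-step : ∀ j → Up j → Up (nxt j)
    -- A descent right after an ascent would make the vertices before and after both the parent of
    -- the middle one. They would coincide, which a cycle of length at least three excludes.
    up-step j up = [ (λ down → ⊥-elim (nxt^-≢ 2 j (s≤s z≤n) 3≤k (inj (functional down up)))) , id ]′ (oriented
      (f-adj (nxt j)))
    climb : ∀ j → Up j → ∀ m → Up (nxt^ m j) × h (f j) + m ≤ h (f (nxt^ m j))
    climb j up zero    = up , ℕₚ.≤-reflexive (ℕₚ.+-identityʳ _)
    climb j up (suc m) = let up′ , le = climb j up m in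
      up-step _ up′ , ℕₚ.≤-trans (ℕₚ.≤-reflexive (ℕₚ.+-suc _ m)) (ℕₚ.≤-trans (s≤s le) (descend up′))
    absurd-up : ∃ Up → ⊥
    absurd-up (j , up) = ℕₚ.m+1+n≰m (h (f j))
      (subst (λ i → h (f j) + suc k ≤ h (f i)) (nxt^-n j) (proj₂ (climb j up (suc k))))
    walk : ∀ m → ∃ Up ⊎ h (f (nxt^ m zero)) + m ≤ h (f zero)
    walk zero = inj₂ (ℕₚ.≤-reflexive (ℕₚ.+-identityʳ _))
    walk (suc m) with walk m
    ... | inj₁ up = inj₁ up
    ... | inj₂ le with oriented (f-adj (nxt^ m zero))
    ... | inj₂ up   = inj₁ (_ , up)
    ... | inj₁ down = inj₂ (ℕₚ.≤-trans (ℕₚ.≤-reflexive (ℕₚ.+-suc _ m)) (ℕₚ.≤-trans (ℕₚ.+-monoˡ-≤ m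
      (descend down)) le))
    absurd-down : h (f (nxt^ (suc k) zero)) + suc k ≤ h (f zero) → ⊥
    absurd-down le = ℕₚ.m+1+n≰m (h (f zero)) (subst (λ i → h (f i) + suc k ≤ h (f zero)) (nxt^-n zero) le)

-- The wheel

module WheelGraph {m : ℕ} (3≤n : 3 ≤ suc m) where

  n : ℕ
  n = suc m

  W : Graph
  W = Wheel n

  spoke rim : Fin n → Fin (n + n)
  spoke i = i ↑ˡ n
  rim   i = n ↑ʳ i

  ends-spoke : ∀ i → ends W (spoke i) ≡ (zero , suc i)
  ends-spoke i rewrite Finₚ.splitAt-↑ˡ n i n = refl

  ends-rim : ∀ i → ends W (rim i) ≡ (suc i , suc (nxt i))
  ends-rim i rewrite Finₚ.splitAt-↑ʳ n n i = cong (λ j → suc i , suc j) (sym (nxt≡next i))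

  data EdgeView : Fin (n + n) → Set where
    is-spoke : ∀ i → EdgeView (spoke i)
    is-rim   : ∀ i → EdgeView (rim i)

  edge-view : ∀ e → EdgeView e
  edge-view e with Fin.splitAt n e | Finₚ.join-splitAt n n e
  ... | inj₁ i | refl = is-spoke i
  ... | inj₂ i | refl = is-rim i

  _has_ : Subset (n + n) → Fin (n + n) → Set
  I has e = lookup I e ≡ true

  spoke-adj : ∀ {I i} → I has spoke i → AdjIn W I zero (suc i)
  spoke-adj {I} {i} h = spoke i , Vecₚ.lookup⇒[]= (spoke i) I h , inj₁ (ends-spoke i)

  spoke-adj′ : ∀ {I i} → I has spoke i → AdjIn W I (suc i) zero
  spoke-adj′ {I} {i} h = spoke i , Vecₚ.lookup⇒[]= (spoke i) I h , inj₂ (ends-spoke i)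

  rim-adj : ∀ {I i} → I has rim i → AdjIn W I (suc i) (suc (nxt i))
  rim-adj {I} {i} h = rim i , Vecₚ.lookup⇒[]= (rim i) I h , inj₁ (ends-rim i)

  rim-cycle : ∀ {I} → (∀ i → I has rim i) → HasCycle W I
  rim-cycle {I} h = n , 3≤n , suc , Finₚ.suc-injective ,
    λ j → subst (λ i → AdjIn W I (suc j) (suc i)) (nxt≡next j) (rim-adj (h j))

  -- The cycle is the hub followed by L + 1 consecutive rim vertices: L < n keeps them distinct, and
  -- L > 0 gives length at least three.
  fan-cycle : ∀ {I} a L → 0 < L → L < n → I has spoke a → I has spoke (nxt^ L a) →
              (∀ k → k < L → I has rim (nxt^ k a)) → HasCycle W I
  fan-cycle {I} a L@(suc _) _ L<n ha hL hr = suc (suc L) , s≤s (s≤s (s≤s z≤n)) , f , f-injective ,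
    λ j → subst (λ i → AdjIn W I (f j) (f i)) (nxt≡next j) (f-adj j)
    where
    f : Fin (suc (suc L)) → Fin (suc n)
    f zero    = zero
    f (suc j) = suc (nxt^ (toℕ j) a)
    distinct : ∀ {i j : Fin (suc L)} → toℕ i < toℕ j → nxt^ (toℕ i) a ≢ nxt^ (toℕ j) a
    distinct {i} {j} lt = nxt^-apart (toℕ i) (toℕ j) a lt
      (ℕₚ.≤-trans (Finₚ.toℕ<n j) (ℕₚ.≤-trans L<n (ℕₚ.m≤n+m n (toℕ i))))
    f-injective : ∀ {i j} → f i ≡ f j → i ≡ j
    f-injective {zero}  {zero}  _  = refl
    f-injective {suc i} {suc j} eq with ℕₚ.<-cmp (toℕ i) (toℕ j)
    ... | tri< lt _ _ = contradiction (Finₚ.suc-injective eq) (distinct {i} {j} lt)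
    ... | tri≈ _ e _  = cong suc (Finₚ.toℕ-injective e)
    ... | tri> _ _ gt = contradiction (sym (Finₚ.suc-injective eq)) (distinct {j} {i} gt)
    f-adj : ∀ j → AdjIn W I (f j) (f (nxt j))
    f-adj j with view j
    ... | ‵fromℕ = subst (λ i → AdjIn W I (suc (nxt^ (toℕ (fromℕ L)) a)) (f i)) (sym (nxt-fromℕ (suc L)))
      (spoke-adj′ (subst (λ k → I has spoke (nxt^ k a)) (sym (Finₚ.toℕ-fromℕ L)) hL))
    ... | ‵inject₁ zero = subst (λ i → AdjIn W I zero (f i)) (sym (nxt-inject₁ zero)) (spoke-adj ha)
    ... | ‵inject₁ (suc i) = subst (λ j → AdjIn W I (suc (nxt^ (toℕ (inject₁ i)) a)) (f j)) (sym (nxt-inject₁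
      (suc i)))
      (subst (λ k → AdjIn W I (suc (nxt^ k a)) (suc (nxt^ (suc (toℕ i)) a))) (sym (Finₚ.toℕ-inject₁ i))
        (rim-adj (hr (toℕ i) (Finₚ.toℕ<n i))))

  -- Rim edge i joins rim vertices i and nxt i, so it is the rim edge after spoke i.
  enc : Vertex n → Subset (n + n)
  enc (false , x) = compl x ++ x
  enc (true  , y) = compl y ++ shl y

  lookup-spoke : ∀ (S R : Cube n) i → lookup (S ++ R) (spoke i) ≡ lookup S i
  lookup-spoke S R i = Vecₚ.lookup-++ˡ S R i

  lookup-rim : ∀ (S R : Cube n) i → lookup (S ++ R) (rim i) ≡ lookup R i
  lookup-rim S R i = Vecₚ.lookup-++ʳ S R i

  not-true : ∀ {b} → not b ≡ true → b ≡ false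
  not-true eq = Boolₚ.not-injective eq

  -- Nonconstant vectors give base-cobases

  module Tree (x : Cube n) (π : Fin n → Fin n) (rank : Fin n → ℕ)
              (rank-π : ∀ i → lookup x i ≡ true → rank (π i) < rank i) where

    data Par : Fin (suc n) → Fin (suc n) → Set where
      to-hub : ∀ {i} → lookup x i ≡ false → Par (suc i) zero
      along  : ∀ {i} → lookup x i ≡ true  → Par (suc i) (suc (π i))

    h : Fin (suc n) → ℕ
    h zero    = 0
    h (suc i) = suc (rank i)

    tree-independent : ∀ I → (∀ {u v} → AdjIn W I u v → Par u v ⊎ Par v u) → Independent W I
    tree-independent I = forest-independent W I Par h functional descend
      where
      functional : ∀ {u v w} → Par u v → Par u w → v ≡ w
      functional (to-hub p) (to-hub q) = refl
      functional (to-hub p) (along  q) = contradiction (trans (sym p) q) λ ()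
      functional (along  p) (to-hub q) = contradiction (trans (sym p) q) λ ()
      functional (along  p) (along  q) = refl
      descend : ∀ {u v} → Par u v → h v < h u
      descend (to-hub p)    = s≤s z≤n
      descend (along {i} p) = s≤s (rank-π i p)

  adj-cases : ∀ {I u v} (P : Fin (suc n) → Fin (suc n) → Set) →
              (∀ i → I has spoke i → P (suc i) zero) →
              (∀ i → I has rim i → P (suc i) (suc (nxt i)) ⊎ P (suc (nxt i)) (suc i)) →
              AdjIn W I u v → P u v ⊎ P v u
  adj-cases {I} P ps pr (e , e∈I , eq) with edge-view e
  ... | is-spoke i with Vecₚ.[]=⇒lookup e∈I
  ... | h rewrite ends-spoke i = [ (λ { refl → inj₂ (ps i h) }) , (λ { refl → inj₁ (ps i h) }) ]′ eq
  adj-cases {I} P ps pr (e , e∈I , eq) | is-rim i with pr i (Vecₚ.[]=⇒lookup e∈I)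
  ... | p rewrite ends-rim i = [ (λ { refl → p }) , (λ { refl → Sum.swap p }) ]′ eq

  dist : Fin n → Fin n → ℕ
  dist i z = proj₁ (reach i z)

  dist-< : ∀ i z → dist i z < n
  dist-< i z = proj₁ (proj₂ (reach i z))

  nxt^-dist : ∀ i z → nxt^ (dist i z) i ≡ z
  nxt^-dist i z = proj₂ (proj₂ (reach i z))

  nxt^-unique : ∀ {a b} i → a < n → b < n → nxt^ a i ≡ nxt^ b i → a ≡ b
  nxt^-unique {a} {b} i a<n b<n eq with ℕₚ.<-cmp a b
  ... | tri< lt _ _ = contradiction eq (nxt^-apart a b i lt (ℕₚ.<-≤-trans b<n (ℕₚ.m≤n+m n a)))
  ... | tri≈ _ e _  = e
  ... | tri> _ _ gt = contradiction (sym eq) (nxt^-apart b a i gt (ℕₚ.<-≤-trans a<n (ℕₚ.m≤n+m n b)))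

  dist-nxtˡ : ∀ i z → i ≢ z → dist (nxt i) z < dist i z
  dist-nxtˡ i z i≢z with dist i z in eq
  ... | zero  = contradiction (trans (cong (λ k → nxt^ k i) (sym eq)) (nxt^-dist i z)) i≢z
  ... | suc k = ℕₚ.≤-reflexive (cong suc (nxt^-unique (nxt i) (dist-< (nxt i) z)
    (ℕₚ.<⇒≤ (subst (_< n) eq (dist-< i z)))
    (trans (nxt^-dist (nxt i) z) (trans (sym (nxt^-dist i z)) (trans (cong (λ k → nxt^ k i) eq) (sym
      (nxt^-nxt k i)))))))

  dist-nxtʳ : ∀ z i → nxt i ≢ z → dist z i < dist z (nxt i)
  dist-nxtʳ z i i≢z with dist z (nxt i) in eq
  ... | zero  = contradiction (sym (trans (cong (λ k → nxt^ k z) (sym eq)) (nxt^-dist z (nxt i)))) i≢z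
  ... | suc k = ℕₚ.≤-reflexive (cong suc (nxt^-unique z (dist-< z i)
    (ℕₚ.<⇒≤ (subst (_< n) eq (dist-< z (nxt i))))
    (trans (nxt^-dist z i) (nxt-injective (trans (sym (nxt^-dist z (nxt i))) (cong (λ k → nxt^ k z) eq))))))

  -- Each rim vertex owns one edge, its spoke or the rim edge to its successor (layer false) or
  -- predecessor (layer true); this is its edge to its parent. Some zero z of the vector exists, so
  -- a walk along owned rim edges approaches z and must reach the hub.
  enc-independent : ∀ v → NonConst v → Independent W (enc v)
  enc-independent (false , x) (_ , x≢1) = tree-independent (compl x ++ x) (adj-cases Par spokes rims)
    where
    z = proj₁ (differ (K true) x (x≢1 ∘ sym))
    xz : lookup x z ≡ false
    xz = trans (proj₂ (differ (K true) x (x≢1 ∘ sym))) (cong not (lookup-K z true))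
    rank-nxt : ∀ i → lookup x i ≡ true → dist (nxt i) z < dist i z
    rank-nxt i xi = dist-nxtˡ i z λ { refl → contradiction (trans (sym xi) xz) λ () }
    open Tree x nxt (λ i → dist i z) rank-nxt
    spokes : ∀ i → (compl x ++ x) has spoke i → Par (suc i) zero
    spokes i h = to-hub (not-true (trans (sym (lookup-compl x i)) (trans (sym (lookup-spoke (compl x) x i)) h)))
    rims : ∀ i → (compl x ++ x) has rim i → Par (suc i) (suc (nxt i)) ⊎ Par (suc (nxt i)) (suc i)
    rims i h = inj₁ (along (trans (sym (lookup-rim (compl x) x i)) h))
  enc-independent (true , y) (_ , y≢1) = tree-independent (compl y ++ shl y) (adj-cases Par spokes rims)
    where
    z = proj₁ (differ (K true) y (y≢1 ∘ sym))
    yz : lookup y z ≡ false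
    yz = trans (proj₂ (differ (K true) y (y≢1 ∘ sym))) (cong not (lookup-K z true))
    rank-prev : ∀ i → lookup y i ≡ true → dist z (prev i) < dist z i
    rank-prev i yi = subst (λ k → dist z (prev i) < dist z k) (nxt-prev i)
      (dist-nxtʳ z (prev i) λ eq → contradiction (trans (sym yi) (trans (cong (lookup y) (trans (sym
        (nxt-prev i)) eq)) yz)) λ ())
    open Tree y prev (dist z) rank-prev
    spokes : ∀ i → (compl y ++ shl y) has spoke i → Par (suc i) zero
    spokes i h = to-hub (not-true (trans (sym (lookup-compl y i)) (trans (sym (lookup-spoke (compl y)
      (shl y) i)) h)))
    rims : ∀ i → (compl y ++ shl y) has rim i → Par (suc i) (suc (nxt i)) ⊎ Par (suc (nxt i)) (suc i)
    rims i h = inj₂ (subst (λ j → Par (suc (nxt i)) (suc j)) (prev-nxt i)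
      (along (trans (sym (lookup-shl y i)) (trans (sym (lookup-rim (compl y) (shl y) i)) h))))

  -- Extending a path of rim edges that starts at a spoke until it meets another spoke or closes up.
  forward-cycle : ∀ {I} i → I has spoke i → I has rim i → (∀ j → I has rim j ⊎ I has spoke j) → HasCycle W I
  forward-cycle {I} i hs hr h = [ id , (λ all → rim-cycle λ j → let k , k<n , eq = reach i j in subst (λ j →
    I has rim j) eq (all k k<n)) ]′
      (go m ℕₚ.≤-refl)
    where
    go : ∀ k → k < n → HasCycle W I ⊎ (∀ l → l < suc k → I has rim (nxt^ l i))
    go zero    _   = inj₂ λ { zero _ → hr ; (suc l) (s≤s ()) }
    go (suc k) k<n with go k (ℕₚ.<⇒≤ k<n)
    ... | inj₁ c   = inj₁ c
    ... | inj₂ all with h (nxt^ (suc k) i)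
    ... | inj₂ hs′ = inj₁ (fan-cycle i (suc k) (s≤s z≤n) k<n hs hs′ all)
    ... | inj₁ hr′ = inj₂ λ l l< → [ all l , (λ { refl → hr′ }) ]′ (ℕₚ.m≤n⇒m<n∨m≡n (ℕₚ.≤-pred l<))

  -- The mirror image for layer true: the final spoke at `nxt i` stays fixed and the start a of the
  -- rim path moves backwards.
  backward-cycle : ∀ {I} i → I has spoke (nxt i) → I has rim i → (∀ j → I has rim j ⊎ I has spoke (nxt j)) →
    HasCycle W I
  backward-cycle {I} i hs hr h with go m ℕₚ.≤-refl
    where
    go : ∀ k → k < n → HasCycle W I ⊎ (∃ λ a → nxt^ (suc k) a ≡ nxt i × (∀ l → l < suc k → I has rim
      (nxt^ l a)))
    go zero    _   = inj₂ (i , refl , λ { zero _ → hr ; (suc l) (s≤s ()) })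
    go (suc k) k<n with go k (ℕₚ.<⇒≤ k<n)
    ... | inj₁ c   = inj₁ c
    ... | inj₂ (a , eq , all) with h (prev a)
    ... | inj₂ hs′ = inj₁ (fan-cycle a (suc k) (s≤s z≤n) k<n (subst (λ j → I has spoke j) (nxt-prev a) hs′)
      (subst (λ j → I has spoke j) (sym eq) hs) all)
    ... | inj₁ hr′ = inj₂ (prev a , trans (shift (suc k)) eq ,
      λ { zero _ → hr′ ; (suc l) (s≤s l<) → subst (λ j → I has rim j) (sym (shift l)) (all l l<) })
      where
      shift : ∀ l → nxt^ (suc l) (prev a) ≡ nxt^ l a
      shift l = trans (sym (nxt^-nxt l (prev a))) (cong (nxt^ l) (nxt-prev a))
  ... | inj₁ c = c
  ... | inj₂ (a , _ , all) = rim-cycle λ j → let k , k<n , eq = reach a j in subst (λ j → I has rim j) eq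
    (all k k<n)

  has-∪ˡ : ∀ {I} e e′ → I has e′ → (I ∪ ⁅ e ⁆) has e′
  has-∪ˡ {I} e e′ h = trans (Vecₚ.lookup-zipWith _∨_ e′ I ⁅ e ⁆) (cong (_∨ lookup ⁅ e ⁆ e′) h)

  has-∪ʳ : ∀ {I} e → (I ∪ ⁅ e ⁆) has e
  has-∪ʳ {I} e = Vecₚ.[]=⇒lookup (Subsetₚ.q⊆p∪q I ⁅ e ⁆ (Subsetₚ.x∈⁅x⁆ e))

  bit-cases : ∀ b {P Q : Set} → (b ≡ true → P) → (b ≡ false → Q) → P ⊎ Q
  bit-cases true  p q = inj₁ (p refl)
  bit-cases false p q = inj₂ (q refl)

  spoke-on : ∀ x R i → lookup x i ≡ false → (compl x ++ R) has spoke i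
  spoke-on x R i eq = trans (lookup-spoke (compl x) R i) (trans (lookup-compl x i) (cong not eq))

  rim-on : ∀ S R i → lookup R i ≡ true → (S ++ R) has rim i
  rim-on S R i eq = trans (lookup-rim S R i) eq

  absent : ∀ {I e} → e ∉ I → ¬ I has e
  absent {I} {e} e∉ h = e∉ (Vecₚ.lookup⇒[]= e I h)

  -- A code contains exactly one edge of each pair of a spoke and the rim edge after it (layer
  -- false) or before it (layer true). A new edge completes one pair, from which a cycle can be
  -- grown.
  enc-maximal : ∀ v e → e ∉ enc v → HasCycle W (enc v ∪ ⁅ e ⁆)
  enc-maximal (false , x) e e∉ = go (edge-view e)
    where
    B = compl x ++ x
    either : ∀ j → (B ∪ ⁅ e ⁆) has rim j ⊎ (B ∪ ⁅ e ⁆) has spoke j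
    either j = bit-cases (lookup x j) (has-∪ˡ {B} e (rim j) ∘ rim-on (compl x) x j) (has-∪ˡ {B} e
      (spoke j) ∘ spoke-on x x j)
    go : EdgeView e → HasCycle W (B ∪ ⁅ e ⁆)
    go (is-spoke i) = forward-cycle i (has-∪ʳ {B} e)
      (has-∪ˡ {B} e (rim i) (rim-on (compl x) x i (Boolₚ.¬-not (absent {B} e∉ ∘ spoke-on x x i)))) either
    go (is-rim i)   = forward-cycle i
      (has-∪ˡ {B} e (spoke i) (spoke-on x x i (Boolₚ.¬-not (absent {B} e∉ ∘ rim-on (compl x) x i))))
        (has-∪ʳ {B} e) either
  enc-maximal (true , y) e e∉ = go (edge-view e)
    where
    B = compl y ++ shl y
    rim-on′ : ∀ j → lookup y (nxt j) ≡ true → B has rim j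
    rim-on′ j eq = rim-on (compl y) (shl y) j (trans (lookup-shl y j) eq)
    either : ∀ j → (B ∪ ⁅ e ⁆) has rim j ⊎ (B ∪ ⁅ e ⁆) has spoke (nxt j)
    either j = bit-cases (lookup y (nxt j)) (has-∪ˡ {B} e (rim j) ∘ rim-on′ j) (has-∪ˡ {B} e (spoke
      (nxt j)) ∘ spoke-on y (shl y) (nxt j))
    go : EdgeView e → HasCycle W (B ∪ ⁅ e ⁆)
    go (is-spoke i) = backward-cycle (prev i)
      (subst (λ j → (B ∪ ⁅ e ⁆) has spoke j) (sym (nxt-prev i)) (has-∪ʳ {B} e))
      (has-∪ˡ {B} e (rim (prev i)) (rim-on′ (prev i)
        (trans (cong (lookup y) (nxt-prev i)) (Boolₚ.¬-not (absent {B} e∉ ∘ spoke-on y (shl y) i))))) either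
    go (is-rim i)   = backward-cycle i
      (has-∪ˡ {B} e (spoke (nxt i)) (spoke-on y (shl y) (nxt i) (Boolₚ.¬-not (absent {B} e∉ ∘ rim-on′ i))))
        (has-∪ʳ {B} e) either

  enc-base : ∀ v → NonConst v → IsBase W (enc v)
  enc-base v nc = enc-independent v nc , λ e e∉ ind → ind (enc-maximal v e e∉)

  ∁-enc : ∀ v → ∁ (enc v) ≡ enc (proj₁ v , compl (proj₂ v))
  ∁-enc (false , x) = Vecₚ.map-++ not (compl x) x
  ∁-enc (true  , y) = trans (Vecₚ.map-++ not (compl y) (shl y)) (cong (compl (compl y) ++_) (sym (compl-shl y)))

  enc-base-cobase : ∀ v → NonConst v → IsBaseCobase W (enc v)
  enc-base-cobase (ε , x) nc@(≢0 , ≢1) = enc-base (ε , x) nc ,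
    subst (IsBase W) (sym (∁-enc (ε , x))) (enc-base (ε , compl x) (compl-≢K true ≢1 , compl-≢K false ≢0))

  -- Every base-cobase comes from a nonconstant vector

  module Classify (B : Subset (n + n)) (ind : Independent W B) (ind′ : Independent W (∁ B)) where

    s r : Fin n → Bool
    s i = lookup B (spoke i)
    r i = lookup B (rim i)

    colour : Bool → Subset (n + n)
    colour true  = B
    colour false = ∁ B

    colour-has : ∀ c e → lookup B e ≡ c → colour c has e
    colour-has true  e eq = eq
    colour-has false e eq = trans (lookup-compl B e) (cong not eq)

    colour-independent : ∀ c → Independent W (colour c)
    colour-independent true  = ind
    colour-independent false = ind′

    rim-nonconst : ∀ c → ¬ (∀ i → r i ≡ c)
    rim-nonconst c eq = colour-independent c (rim-cycle λ i → colour-has c (rim i) (eq i))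

    no-fan : ∀ c a L → 0 < L → L < n → s a ≡ c → (∀ k → k < L → r (nxt^ k a) ≡ c) → s (nxt^ L a) ≡ not c
    no-fan c a L 0<L L<n sa ra = Boolₚ.¬-not λ sL → colour-independent c
      (fan-cycle a L 0<L L<n (colour-has c (spoke a) sa) (colour-has c (spoke (nxt^ L a)) sL)
        λ k k<L → colour-has c (rim (nxt^ k a)) (ra k k<L))

    -- Since no colour contains a fan, a spoke coloured like the rim edge after it
    -- determines the colours of all later spokes.
    module _ (b : Fin n) (sb : s b ≡ r b) where

      -- A block of q + 1 rim edges of one colour that ends at offset k from b and is opened by a
      -- spoke of that colour. The bound q ≤ k keeps the block from exceeding n edges.
      Run : ℕ → Set
      Run k = ∃ λ a → ∃ λ q → q ≤ k × nxt^ q a ≡ nxt^ k b × s a ≡ r a × (∀ l → l ≤ q → r (nxt^ l a) ≡ r a)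

      -- A spoke of the same colour after the block would close a fan; a block of n edges would be a
      -- rim of one colour.
      run-end : ∀ k → k < n → Run k → s (nxt^ (suc k) b) ≡ not (r (nxt^ k b))
      run-end k k<n (a , q , q≤k , eq , sa , ra) with ℕₚ.m≤n⇒m<n∨m≡n (ℕₚ.≤-trans (s≤s q≤k) k<n)
      ... | inj₁ q<n = begin
        s (nxt^ (suc k) b)   ≡⟨ cong (s ∘ nxt) eq ⟨
        s (nxt^ (suc q) a)   ≡⟨ no-fan (r a) a (suc q) (s≤s z≤n) q<n sa (λ l l< → ra l (ℕₚ.≤-pred l<)) ⟩
        not (r a)            ≡⟨ cong not (ra q ℕₚ.≤-refl) ⟨
        not (r (nxt^ q a))   ≡⟨ cong (not ∘ r) eq ⟩
        not (r (nxt^ k b))   ∎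
        where open ≡-Reasoning
      ... | inj₂ refl = ⊥-elim (rim-nonconst (r a) λ i → let l , l<n , eq′ = reach a i in
        trans (cong r (sym eq′)) (ra l (ℕₚ.≤-pred l<n)))

      run : ∀ k → k < n → Run k
      run zero    _   = b , 0 , z≤n , refl , sb , λ { zero _ → refl }
      run (suc k) k<n with run k (ℕₚ.<⇒≤ k<n)
      ... | R@(a , q , q≤k , eq , sa , ra) with r (nxt^ (suc k) b) Boolₚ.≟ r (nxt^ k b)
      ... | yes same = a , suc q , s≤s q≤k , cong nxt eq , sa ,
        λ l l≤ → [ (λ l< → ra l (ℕₚ.≤-pred l<)) , (λ { refl → trans (cong (r ∘ nxt) eq) (trans same (trans
          (cong r (sym eq)) (ra q ℕₚ.≤-refl))) }) ]′ (ℕₚ.m≤n⇒m<n∨m≡n l≤)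
      -- The colour changes: the next spoke is opposite to the old rim edge, so it agrees with the
      -- new one and opens a block of one edge.
      ... | no diff = nxt^ (suc k) b , 0 , z≤n , refl , trans (run-end k (ℕₚ.<⇒≤ k<n) R) (sym
        (Boolₚ.¬-not diff)) ,
        λ { zero _ → refl }

      propagate : ∀ i → s (nxt i) ≡ not (r i)
      propagate i = let k , k<n , eq = reach b i in
        subst (λ j → s (nxt j) ≡ not (r j)) eq (run-end k k<n (run k k<n))

    S R : Cube n
    S = tabulate s
    R = tabulate r

    B≡S++R : B ≡ S ++ R
    B≡S++R = cube-ext λ e → go (edge-view e)
      where
      go : ∀ {e} → EdgeView e → lookup B e ≡ lookup (S ++ R) e
      go (is-spoke i) = sym (trans (lookup-spoke S R i) (Vecₚ.lookup∘tabulate s i))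
      go (is-rim i)   = sym (trans (lookup-rim S R i) (Vecₚ.lookup∘tabulate r i))

    classify : ∃ λ v → NonConst v × B ≡ enc v
    classify with Finₚ.any? (λ b → s b Boolₚ.≟ r b)
    ... | no none = (false , R) , (R≢K false , R≢K true) , trans B≡S++R (cong (_++ R) S≡)
      where
      R≢K : ∀ c → R ≢ K c
      R≢K c eq = rim-nonconst c λ i → trans (sym (Vecₚ.lookup∘tabulate r i)) (trans (cong (λ x →
        lookup x i) eq) (lookup-K i c))
      S≡ : S ≡ compl R
      S≡ = cube-ext λ i → trans (Vecₚ.lookup∘tabulate s i) (trans (Boolₚ.¬-not λ eq → none (i , eq))
        (trans (cong not (sym (Vecₚ.lookup∘tabulate r i))) (sym (lookup-compl R i))))
    ... | yes (b , sb) = (true , compl S) , (≢K false , ≢K true) ,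
      trans B≡S++R (cong₂ _++_ (sym (compl-compl S)) (cube-ext λ i → trans (Vecₚ.lookup∘tabulate r i) (sym
        (R≡ i))))
      where
      R≡ : ∀ i → lookup (shl (compl S)) i ≡ r i
      R≡ i = begin
        lookup (shl (compl S)) i   ≡⟨ lookup-shl (compl S) i ⟩
        lookup (compl S) (nxt i)   ≡⟨ lookup-compl S (nxt i) ⟩
        not (lookup S (nxt i))     ≡⟨ cong not (trans (Vecₚ.lookup∘tabulate s (nxt i)) (propagate b sb i)) ⟩
        not (not (r i))            ≡⟨ Boolₚ.not-involutive (r i) ⟩
        r i                        ∎
        where open ≡-Reasoning
      ≢K : ∀ c → compl S ≢ K c
      ≢K c eq = rim-nonconst c λ i → trans (sym (R≡ i)) (trans (cong (λ x → lookup (shl x) i) eq) (trans (cong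
        (λ x → lookup x i) (shl-K c)) (lookup-K i c)))

  -- The encoding embeds the layered graph

  shl-fixed : ∀ (x : Cube n) → shl x ≡ x → x ≡ K (lookup x zero)
  shl-fixed x eq = cube-ext λ i → let k , _ , eq′ = reach zero i in
    trans (cong (lookup x) (sym eq′)) (trans (go k) (sym (lookup-K i (lookup x zero))))
    where
    go : ∀ k → lookup x (nxt^ k zero) ≡ lookup x zero
    go zero    = refl
    go (suc k) = trans (sym (lookup-shl x (nxt^ k zero))) (trans (cong (λ z → lookup z (nxt^ k zero)) eq)
      (go k))

  -- Comparing spokes gives x = y and comparing rim edges x = shl y, so x is invariant under
  -- rotation and hence constant.
  enc-layers : ∀ x y → NonConst (false , x) → enc (false , x) ≢ enc (true , y)
  enc-layers x y (≢0 , ≢1) eq = const (lookup x zero) (shl-fixed x (trans (cong shl x≡y) (sym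
    (Vecₚ.++-injectiveʳ (compl x) (compl y) eq))))
    where
    x≡y : x ≡ y
    x≡y = compl-injective (Vecₚ.++-injectiveˡ (compl x) (compl y) eq)
    const : ∀ c → x ≢ K c
    const false = ≢0
    const true  = ≢1

  enc-injective : ∀ {v w} → NonConst v → NonConst w → enc v ≡ enc w → v ≡ w
  enc-injective {false , x} {false , y} _ _ eq = cong (false ,_) (Vecₚ.++-injectiveʳ (compl x) (compl y) eq)
  enc-injective {true  , x} {true  , y} _ _ eq = cong (true ,_) (compl-injective (Vecₚ.++-injectiveˡ (compl x)
    (compl y) eq))
  enc-injective {false , x} {true  , y} nx _ eq = ⊥-elim (enc-layers x y nx eq)
  enc-injective {true  , x} {false , y} _ ny eq = ⊥-elim (enc-layers y x ny (sym eq))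

  d-++ : ∀ {k l} (a b : Cube k) (x y : Cube l) → d (a ++ x) (b ++ y) ≡ d a b + d x y
  d-++ []      []      x y = refl
  d-++ (c ∷ a) (e ∷ b) x y = trans (cong (δ c e +_) (d-++ a b x y)) (sym (ℕₚ.+-assoc (δ c e) (d a b) (d x y)))

  symdiff-size : ∀ {k} (A B : Subset k) → ∣ (A ─ B) ∪ (B ─ A) ∣ ≡ d A B
  symdiff-size []          []          = refl
  symdiff-size (false ∷ A) (false ∷ B) = symdiff-size A B
  symdiff-size (false ∷ A) (true  ∷ B) = cong suc (symdiff-size A B)
  symdiff-size (true  ∷ A) (false ∷ B) = cong suc (symdiff-size A B)
  symdiff-size (true  ∷ A) (true  ∷ B) = symdiff-size A B

  enc-adj : ∀ {v w} → E v w → BCAdj (enc v) (enc w)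
  enc-adj {v} {w} e = trans (symdiff-size (enc v) (enc w)) (go e)
    where
    go : ∀ {v w} → E v w → d (enc v) (enc w) ≡ 2
    go (within {false} {x} {y} e) = trans (d-++ (compl x) (compl y) x y) (cong₂ _+_ (trans (d-compl x y) e) e)
    go (within {true}  {x} {y} e) = trans (d-++ (compl x) (compl y) (shl x) (shl y)) (cong₂ _+_ (trans
      (d-compl x y) e) (trans (d-shl x y) e))
    go (across {x} {y} e) = trans (d-++ (compl x) (compl y) x (shl y)) (trans (cong (_+ d x (shl y))
      (d-compl x y)) e)
    go (back {x} {y} e)   = trans (d-sym (enc (true , y)) (enc (false , x))) (go (across {x = x} {y} e))

  hamiltonian : (∀ (u v : Vertex n) → NonConst u → NonConst v → u ≢ v → Cover E NonConst u v) →
                BaseCobaseGraphHamiltonianConnected W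
  hamiltonian conn A B bcA bcB A≢B
    with Classify.classify A (proj₁ (proj₁ bcA)) (proj₁ (proj₂ bcA)) | Classify.classify B (proj₁ (proj₁ bcB))
      (proj₁ (proj₂ bcB))
  ... | u , nu , refl | v , nv , refl = cover⇒hamiltonian {R = BCAdj} (cover-resp to from
    (cover-map {_≈_ = BCAdj} enc enc-injective enc-adj (conn u v nu nv (A≢B ∘ cong enc))))
    where
    to : ∀ {C} → (∃ λ w → NonConst w × C ≡ enc w) → IsBaseCobase W C
    to (w , nw , refl) = enc-base-cobase w nw
    from : ∀ {C} → IsBaseCobase W C → ∃ λ w → NonConst w × C ≡ enc w
    from {C} bc = Classify.classify C (proj₁ (proj₁ bc)) (proj₁ (proj₂ bc))

theorem4p8 : (n : ℕ) → 3 ≤ n → BaseCobaseGraphHamiltonianConnected (Wheel n)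
theorem4p8 0 ()
theorem4p8 1 (s≤s ())
theorem4p8 2 (s≤s (s≤s ()))
theorem4p8 3 3≤n = WheelGraph.hamiltonian 3≤n connected₃
theorem4p8 4 3≤n = WheelGraph.hamiltonian 3≤n connected₄
theorem4p8 (suc (suc (suc (suc (suc k))))) 3≤n =
  WheelGraph.hamiltonian 3≤n (Large.connected (s≤s (s≤s (s≤s (s≤s (s≤s z≤n))))))
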